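{- Let $l\ge2$ be an integer and let $L_{rel}$ be a first-order language with relational vocabulary $\{R_1,\ldots,R_\rho\}$, $\rho>0$, where each $R_k$ has arity $r_k\ge2$. Suppose that every relation symbol has arity $\le l$. For every $I\subseteq\{1,\ldots,\rho\}$ the following hold: (i) There is an $L_{rel}$-formula $\xi(x,y)$ such that for almost all $\mathcal{M}\in\mathbf{S}^I$ the following holds: for every strong $l$-colouring $\gamma:M\to\{1,\ldots,l\}$ of $\mathcal{M}$ and all $a,b\in M$, $\gamma(a)=\gamma(b)$ if and only if $\mathcal{M}\models\xi(a,b)$. (ii) Almost all $\mathcal{M}\in\mathbf{S}^I$ are uniquely strongly $l$-colourable. (iii) $\mathbf{S}^I$ has a zero-one law.
   Context: A strong $l$-colouring of an $L_{rel}$-structure $\mathcal{M}$ is a function $\gamma:M\to\{1,\ldots,l\}$ such that for every $k$ and every $(a_1,\ldots,a_{r_k})\in R_k^{\mathcal{M}}$, $\gamma(a_i)\ne\gamma(a_j)$ whenever $i\neq j$. $\mathcal{M}$ is strongly $l$-colourable if it has a strong $l$-colouring, and uniquely strongly $l$-colourable if it is strongly $l$-colourable and for all strong $l$-colourings $\gamma,\gamma'$ of $\mathcal{M}$ and all $a,b\in M$, $\gamma(a)=\gamma(b)\Leftrightarrow\gamma'(a)=\gamma'(b)$. For $I\subseteq\{1,\ldots,\rho\}$, $\mathbf{S}^I_n$ is the set of strongly $l$-colourable $L_{rel}$-structures $\mathcal{M}$ with universe $\{1,\ldots,n\}$ such that for every $k\in I$, $R_k^{\mathcal{M}}$ is irreflexive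 (all entries of each tuple in it are distinct) and symmetric (closed under permuting the entries of tuples). $\mathbf{S}^I=\bigcup_{n\geq 1}\mathbf{S}^I_n$. "Almost all $\mathcal{M}\in\mathbf{S}^I$ have property $P$" means that the proportion of $\mathcal{M}\in\mathbf{S}^I_n$ with property $P$ approaches $1$ as $n\to\infty$. "$\mathbf{S}^I$ has a zero-one law" means that for every $L_{rel}$-sentence $\varphi$, either $\varphi$ or $\neg\varphi$ is satisfied by almost all $\mathcal{M}\in\mathbf{S}^I$. -}

module Defs where

open import Data.Bool using (Bool; true)
open import Data.Fin using (Fin)
open import Data.Fin.Permutation using (Permutation′; _⟨$⟩ʳ_)
open import Data.Fin.Subset using (Subset; _∈_)
open import Data.Integer using (+_)
open import Data.List using (List; length)
import Data.List.Membership.Setoid as Membership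
import Data.List.Relation.Unary.Unique.Setoid as UniqueSetoid
open import Data.Nat using (ℕ; suc; NonZero; _≥_)
open import Data.Product using (Σ; ∃; _×_)
open import Data.Rational using (ℚ; 0ℚ; 1ℚ; _/_; _-_; ∣_∣; _<_)
open import Data.Sum using (_⊎_)
open import Data.Vec using (Vec; _∷_; []; lookup; map; tabulate)
open import Data.Vec.Relation.Unary.Unique.Propositional using (Unique)
open import Function.Bundles using (_⇔_)
open import Level using (0ℓ)
open import Relation.Binary.Bundles using (Setoid)
open import Relation.Binary.PropositionalEquality
  using (_≡_; _≢_; refl; sym; trans)
open import Relation.Nullary using (¬_)

record Vocabulary : Set where
  field
    ρ     : ℕ
    arity : Fin ρ → ℕ

open Vocabulary public

-- Structures with universe Fin n. Interpretations are Bool-valued so that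
-- there are finitely many structures on Fin n, up to the equality _≈ₛ_ below.

record Structure (L : Vocabulary) (n : ℕ) : Set where
  field
    interp : (k : Fin (ρ L)) → Vec (Fin n) (arity L k) → Bool

open Structure public

module _ {L : Vocabulary} {n : ℕ} where

  Holds : Structure L n → (k : Fin (ρ L)) → Vec (Fin n) (arity L k) → Set
  Holds M k a = interp M k a ≡ true

  _≈ₛ_ : Structure L n → Structure L n → Set
  M ≈ₛ N = ∀ k a → interp M k a ≡ interp N k a

structureSetoid : Vocabulary → ℕ → Setoid 0ℓ 0ℓ
structureSetoid L n = record
  { Carrier       = Structure L n
  ; _≈_           = _≈ₛ_
  ; isEquivalence = record
    { refl  = λ k a → refl
    ; sym   = λ p k a → sym (p k a)
    ; trans = λ p q k a → trans (p k a) (q k a)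
    }
  }

-- First-order formulas with equality. The free variables of a Formula L m are
-- de Bruijn indices in Fin m; a quantifier binds index zero.

infix  8 _≐_
infix  7 ¬′_ ∀′_ ∃′_
infixr 6 _∧′_
infixr 5 _∨′_
infixr 4 _⇒′_

data Formula (L : Vocabulary) (m : ℕ) : Set where
  _≐_ : Fin m → Fin m → Formula L m
  rel : (k : Fin (ρ L)) → Vec (Fin m) (arity L k) → Formula L m
  ¬′_ : Formula L m → Formula L m
  _∧′_ _∨′_ _⇒′_ : Formula L m → Formula L m → Formula L m
  ∀′_ ∃′_ : Formula L (suc m) → Formula L m

Sentence : Vocabulary → Set
Sentence L = Formula L 0

infix 3 _⊨_[_]

_⊨_[_] : ∀ {L n m} → Structure L n → Formula L m → Vec (Fin n) m → Set
M ⊨ x ≐ y   [ e ] = lookup e x ≡ lookup e y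
M ⊨ rel k t [ e ] = Holds M k (map (lookup e) t)
M ⊨ ¬′ φ    [ e ] = ¬ (M ⊨ φ [ e ])
M ⊨ φ ∧′ ψ  [ e ] = (M ⊨ φ [ e ]) × (M ⊨ ψ [ e ])
M ⊨ φ ∨′ ψ  [ e ] = (M ⊨ φ [ e ]) ⊎ (M ⊨ ψ [ e ])
M ⊨ φ ⇒′ ψ  [ e ] = M ⊨ φ [ e ] → M ⊨ ψ [ e ]
M ⊨ ∀′ φ    [ e ] = ∀ a → M ⊨ φ [ a ∷ e ]
M ⊨ ∃′ φ    [ e ] = ∃ λ a → M ⊨ φ [ a ∷ e ]

module _ {L : Vocabulary} {n : ℕ} where

  StrongColouring : (l : ℕ) → Structure L n → (Fin n → Fin l) → Set
  StrongColouring l M γ =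
    ∀ k (a : Vec (Fin n) (arity L k)) → Holds M k a →
    ∀ i j → i ≢ j → γ (lookup a i) ≢ γ (lookup a j)

  StronglyColourable : ℕ → Structure L n → Set
  StronglyColourable l M = ∃ λ γ → StrongColouring l M γ

  UniquelyStronglyColourable : ℕ → Structure L n → Set
  UniquelyStronglyColourable l M =
    StronglyColourable l M ×
    (∀ γ γ′ → StrongColouring l M γ → StrongColouring l M γ′ →
     ∀ a b → γ a ≡ γ b ⇔ γ′ a ≡ γ′ b)

  IrreflexiveAt : Structure L n → Fin (ρ L) → Set
  IrreflexiveAt M k = ∀ a → Holds M k a → Unique a

  SymmetricAt : Structure L n → Fin (ρ L) → Set
  SymmetricAt M k =
    ∀ (π : Permutation′ (arity L k)) a → Holds M k a →
    Holds M k (tabulate λ i → lookup a (π ⟨$⟩ʳ i))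

  -- Membership in the class 𝐒ᴵₙ.

  InS : ℕ → Subset (ρ L) → Structure L n → Set
  InS l I M =
    StronglyColourable l M ×
    (∀ k → k ∈ I → IrreflexiveAt M k × SymmetricAt M k)

-- Exactly c structures on Fin n satisfy P: they are enumerated, without
-- repetition up to _≈ₛ_, by a list of length c.

HasCard : ∀ {L n} → (Structure L n → Set) → ℕ → Set
HasCard {L} {n} P c =
  ∃ λ (Ms : List (Structure L n)) →
    UniqueSetoid.Unique S Ms × (∀ M → (M ∈ₛ Ms) ⇔ P M) × length Ms ≡ c
  where
  S = structureSetoid L n
  open Membership S renaming (_∈_ to _∈ₛ_) using ()

-- q is the proportion, among the structures on Fin n satisfying C, of those
-- that also satisfy P.

HasProportion : ∀ {L n} (C P : Structure L n → Set) → ℚ → Set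
HasProportion C P q =
  ∃ λ p → ∃ λ c → Σ (NonZero c) λ c≢0 →
    HasCard (λ M → C M × P M) p × HasCard C c × q ≡ _/_ (+ p) c {{c≢0}}

-- The proportion of structures with property P in 𝐒ᴵₙ tends to 1 as n → ∞.

AlmostAll : ∀ L → ℕ → Subset (ρ L) → (∀ {n} → Structure L n → Set) → Set
AlmostAll L l I P =
  ∀ (ε : ℚ) → 0ℚ < ε → ∃ λ N → ∀ n → n ≥ N →
  ∃ λ q → HasProportion {L} {n} (InS l I) P q × ∣ q - 1ℚ ∣ < ε

ZeroOneLaw : (L : Vocabulary) → ℕ → Subset (ρ L) → Set
ZeroOneLaw L l I =
  ∀ (φ : Sentence L) →
  AlmostAll L l I (λ M → M ⊨ φ [ [] ]) ⊎ AlmostAll L l I (λ M → M ⊨ ¬′ φ [ [] ])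

{-# OPTIONS --safe #-}

-- Count pairs (M , γ) of a structure and a strong colouring of it. Fix a colouring γ whose classes all have size at
-- least t ≈ √n. For a tuple e, a colour c and a one-point extension Q of the type of e, overwriting M at (v , e) by Q
-- for one candidate v after the other shows that the structures in which no vertex of colour c realises Q over e
-- form an exponentially (in t) small proportion of those coloured by γ, so a union bound over e, c and Q applies.
-- Colourings with a class of size less than t carry a vanishing part of all pairs: moving a vertex from a larger class
-- into the small class never decreases the number of coloured structures, and this can be done in about n ways, while
-- the result comes from at most l · t such moves. Hence almost all pairs have all extension properties up to a given
-- size. Such a pair has an l-clique c through which any two vertices a and b can be exchanged with the elements of
-- their colours, so that γ is the only colouring up to renaming colours and "the same vertices complete both a and b
-- to a clique" defines equality of colours. In particular M has at most l ^ l colourings, which turns the statement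
-- about pairs into one about structures. Finally, any two such structures are equivalent for sentences of bounded
-- quantifier rank by an Ehrenfeucht–Fraïssé game, so a sentence is decided by its truth in a single one of them.

module Submission where

open import Defs
open import Data.Bool as Bool using (Bool; true; false; if_then_else_)
import Data.Bool.Properties as Bool
open import Data.Fin as Fin using (Fin; zero; suc; toℕ)
import Data.Fin.Properties as Fin
open import Data.Fin.Permutation as Perm using (Permutation′; permutation; _⟨$⟩ʳ_; _⟨$⟩ˡ_; flip)
open import Data.Fin.Subset using (Subset)
import Data.Fin.Subset as Subset
import Data.Fin.Subset.Properties as Subset
open import Data.Integer as ℤ using (ℤ)
import Data.Integer.Properties as ℤ
open import Data.List as List using (List; []; _∷_; length; filter; concatMap; allFin; cartesianProductWith)
import Data.List.Properties as List
open import Data.List.Membership.Propositional using (_∈_; _∉_; find; lose)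
open import Data.List.Membership.Propositional.Properties as List∈ using (∈-filter⁺; ∈-filter⁻; ∈-map⁺; ∈-allFin; ∈-cartesianProductWith⁺)
import Data.List.Membership.Setoid as Membership
import Data.List.Membership.Setoid.Properties as Membershipₚ
open import Data.List.Relation.Unary.All as All using (All; []; _∷_)
import Data.List.Relation.Unary.All.Properties as All
open import Data.List.Relation.Unary.AllPairs using ([]; _∷_)
open import Data.List.Relation.Unary.Any as Any using (Any; here; there)
open import Data.List.Relation.Unary.Unique.Propositional using (Unique)
import Data.List.Relation.Unary.Unique.Propositional.Properties as Unique
import Data.List.Relation.Unary.Unique.Setoid as UniqueSetoid
import Data.List.Relation.Unary.Unique.Setoid.Properties as UniqueSetoidₚ
import Data.List.Relation.Unary.Unique.DecSetoid.Properties as UniqueDecSetoid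
import Data.List.Relation.Unary.Any.Properties as Any
open import Data.Nat
open import Data.Nat.Properties
open import Data.Nat.Tactic.RingSolver using (solve-∀)
open import Data.Product using (∃; ∃₂; _×_; _,_; proj₁; proj₂; uncurry)
open import Data.Rational as ℚ using (ℚ; 0ℚ; 1ℚ)
import Data.Rational.Properties as ℚ
import Data.Rational.Unnormalised as ℚᵘ
import Data.Rational.Unnormalised.Properties as ℚᵘ
open import Data.Sum using (_⊎_; inj₁; inj₂)
open import Data.Vec as Vec using (Vec; []; _∷_; lookup; map; tabulate; _++_)
open import Data.Vec.Properties as Vec using (map-cong; map-∘; lookup-map; lookup∘tabulate; tabulate∘lookup; tabulate-∘; tabulate-cong; ∷-injective)
import Data.Vec.Relation.Unary.Unique.Propositional as VecUnique
import Data.Vec.Relation.Unary.Unique.Propositional.Properties as VecUnique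
open import Function using (_∘_; id; _⇔_; mk⇔; Equivalence)
open import Level using (0ℓ)
open import Relation.Binary using (Setoid; DecidableEquality)
open import Relation.Binary.PropositionalEquality hiding ([_]; J)
open import Relation.Nullary using (¬_; Dec; yes; no; does; contradiction)
open import Relation.Nullary.Decidable using (map′; ¬?; _×-dec_; _→-dec_; _⊎-dec_; decidable-stable; dec-true)
open import Relation.Unary using (Decidable)

-- The number of structures coloured by a given `γ` is never computed: it depends on `I`, on the
-- arities and on all class sizes. Weights are only compared, through explicit maps with small
-- fibres (`overwrite`, `twist`). Both maps act on sets of tuples that are closed under permuting
-- entries, so they keep the symmetry required on `I` whatever `I` is.
--
-- The threshold `t` faces two demands: `l * t` must be small against `n` for the moves between
-- classes, while `(d / suc d) ^ t` must beat the `n ^ m` tuples of the union bound. A multiple of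
-- √n meets both with elementary estimates.
--
-- The bounds on one arity shape the clique: at most `l` lets an injective tuple of the relation fit
-- among `l` vertices of different colours, at least 2 makes the relation tell colours apart.
-- Growing this clique over a pair `a`, `b` is what calls for extension properties over tuples
-- shorter than `l + 2`.
--
-- All estimates are inequalities between natural numbers with denominators cleared. Each property
-- in play is decidable, so a structure with the extension properties is found by finite search and
-- a sentence is evaluated in it.

private variable
  A B : Set

-- Sums and counting over lists

𝟙 : {X : Set} → Dec X → ℕ
𝟙 d = if does d then 1 else 0

𝟙-mono : {X Y : Set} → (X → Y) → (d : Dec X) (e : Dec Y) → 𝟙 d ≤ 𝟙 e
𝟙-mono f (no _)  e       = z≤n
𝟙-mono f (yes x) (yes _) = ≤-refl
𝟙-mono f (yes x) (no ¬y) = contradiction (f x) ¬y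

𝟙-yes : {X : Set} → X → (d : Dec X) → 𝟙 d ≡ 1
𝟙-yes x (yes _) = refl
𝟙-yes x (no ¬x) = contradiction x ¬x

𝟙-no : {X : Set} → ¬ X → (d : Dec X) → 𝟙 d ≡ 0
𝟙-no ¬x (yes x) = contradiction x ¬x
𝟙-no ¬x (no _)  = refl

∑ : List A → (A → ℕ) → ℕ
∑ []       f = 0
∑ (x ∷ xs) f = f x + ∑ xs f

∑-mono : {f g : A → ℕ} (xs : List A) → (∀ x → f x ≤ g x) → ∑ xs f ≤ ∑ xs g
∑-mono []       f≤g = z≤n
∑-mono (x ∷ xs) f≤g = +-mono-≤ (f≤g x) (∑-mono xs f≤g)

∑-cong : {f g : A → ℕ} (xs : List A) → (∀ x → f x ≡ g x) → ∑ xs f ≡ ∑ xs g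
∑-cong []       f≡g = refl
∑-cong (x ∷ xs) f≡g = cong₂ _+_ (f≡g x) (∑-cong xs f≡g)

∑-+ : (xs : List A) (f g : A → ℕ) → ∑ xs (λ x → f x + g x) ≡ ∑ xs f + ∑ xs g
∑-+ []       f g = refl
∑-+ (x ∷ xs) f g = begin
  f x + g x + ∑ xs (λ x → f x + g x) ≡⟨ cong (f x + g x +_) (∑-+ xs f g) ⟩
  f x + g x + (∑ xs f + ∑ xs g)      ≡⟨ +-interchange (f x) (g x) _ _ ⟩
  f x + ∑ xs f + (g x + ∑ xs g)      ∎
  where
  open ≡-Reasoning
  +-interchange : ∀ a b c d → a + b + (c + d) ≡ a + c + (b + d)
  +-interchange = solve-∀

∑-*ˡ : (xs : List A) (c : ℕ) (f : A → ℕ) → ∑ xs (λ x → c * f x) ≡ c * ∑ xs f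
∑-*ˡ []       c f = sym (*-zeroʳ c)
∑-*ˡ (x ∷ xs) c f = trans (cong (c * f x +_) (∑-*ˡ xs c f)) (sym (*-distribˡ-+ c (f x) (∑ xs f)))

∑-*ʳ : (xs : List A) (c : ℕ) (f : A → ℕ) → ∑ xs (λ x → f x * c) ≡ ∑ xs f * c
∑-*ʳ xs c f = trans (∑-cong xs λ x → *-comm (f x) c) (trans (∑-*ˡ xs c f) (*-comm c (∑ xs f)))

∑-const : (xs : List A) (c : ℕ) → ∑ xs (λ _ → c) ≡ length xs * c
∑-const []       c = refl
∑-const (x ∷ xs) c = cong (c +_) (∑-const xs c)

∑-zero : (xs : List A) → ∑ xs (λ _ → 0) ≡ 0
∑-zero []       = refl
∑-zero (x ∷ xs) = ∑-zero xs

∑-swap : (xs : List A) (ys : List B) (f : A → B → ℕ) →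
         ∑ xs (λ x → ∑ ys (f x)) ≡ ∑ ys (λ y → ∑ xs (λ x → f x y))
∑-swap []       ys f = sym (∑-zero ys)
∑-swap (x ∷ xs) ys f = trans (cong (∑ ys (f x) +_) (∑-swap xs ys f)) (sym (∑-+ ys (f x) _))

∈⇒≤∑ : {x : A} {xs : List A} (f : A → ℕ) → x ∈ xs → f x ≤ ∑ xs f
∈⇒≤∑ {xs = _ ∷ xs} f (here refl) = m≤m+n _ (∑ xs f)
∈⇒≤∑ {xs = y ∷ xs} f (there p)   = ≤-trans (∈⇒≤∑ f p) (m≤n+m _ (f y))

count : {P : A → Set} → Decidable P → List A → ℕ
count P? xs = ∑ xs (λ x → 𝟙 (P? x))

count-mono : {P Q : A → Set} (P? : Decidable P) (Q? : Decidable Q) (xs : List A) → (∀ x → P x → Q x) →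
    count P? xs ≤ count Q? xs
count-mono P? Q? xs P⊆Q = ∑-mono xs λ x → 𝟙-mono (P⊆Q x) (P? x) (Q? x)

length-filter : {P : A → Set} (P? : Decidable P) (xs : List A) → length (filter P? xs) ≡ count P? xs
length-filter P? []       = refl
length-filter P? (x ∷ xs) with does (P? x)
... | true  = cong suc (length-filter P? xs)
... | false = length-filter P? xs

count-split : {P Q : A → Set} (P? : Decidable P) (Q? : Decidable Q) (xs : List A) →
              count (λ x → P? x ×-dec Q? x) xs + count (λ x → P? x ×-dec ¬? (Q? x)) xs ≡ count P? xs
count-split P? Q? xs = trans (sym (∑-+ xs _ _)) (∑-cong xs λ x → split (P? x) (Q? x))
  where
  split : {X Y : Set} (d : Dec X) (e : Dec Y) → 𝟙 (d ×-dec e) + 𝟙 (d ×-dec ¬? e) ≡ 𝟙 d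
  split (no _)  _       = refl
  split (yes _) (no _)  = refl
  split (yes _) (yes _) = refl

length-concatMap-≤ : (f : A → List B) (D : ℕ) → (∀ x → length (f x) ≤ D) → (xs : List A) →
                     length (concatMap f xs) ≤ D * length xs
length-concatMap-≤ f D bound []       = z≤n
length-concatMap-≤ f D bound (x ∷ xs) = begin
  length (f x List.++ concatMap f xs)        ≡⟨ List.length-++ (f x) ⟩
  length (f x) + length (concatMap f xs)     ≤⟨ +-mono-≤ (bound x) (length-concatMap-≤ f D bound xs) ⟩
  D + D * length xs                          ≡⟨ *-suc D (length xs) ⟨
  D * suc (length xs)                        ∎
  where open ≤-Reasoning

module _ (S : Setoid 0ℓ 0ℓ) where
  private module S = Setoid S
  open S using (Carrier; _≈_)
  open Membership S using () renaming (_∈_ to _∈ˢ_)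
  open UniqueSetoid S using () renaming (Unique to Uniqueˢ)

  private
    extract : ∀ {x ys} → x ∈ˢ ys → ∃ λ zs → length ys ≡ suc (length zs) × (∀ {y} → ¬ x ≈ y → y ∈ˢ ys → y ∈ˢ zs)
    extract {ys = y ∷ ys} (here x≈y) = ys , refl , λ where
      x≉ (here z≈y) → contradiction (S.trans x≈y (S.sym z≈y)) x≉
      x≉ (there q)  → q
    extract {ys = y ∷ ys} (there p) with zs , eq , keep ← extract p = y ∷ zs , cong suc eq , λ where
      x≉ (here z≈y) → here z≈y
      x≉ (there q)  → there (keep x≉ q)

  -- Each entry of `xs` removes its copy from `ys`; the later entries differ from it and survive the
  -- removal.
  unique⇒length≤ : ∀ {xs} ys → Uniqueˢ xs → All (_∈ˢ ys) xs → length xs ≤ length ys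
  unique⇒length≤ ys []         []         = z≤n
  unique⇒length≤ ys (x≉ ∷ uniq) (x∈ ∷ xs⊆) with zs , eq , keep ← extract x∈ =
    ≤-trans (s≤s (unique⇒length≤ zs uniq (All.zipWith (uncurry keep) (x≉ , xs⊆)))) (≤-reflexive (sym eq))

  count≤length : {P : Carrier → Set} (P? : Decidable P) {xs : List Carrier} → Uniqueˢ xs → (zs : List Carrier) →
                 (∀ x → P x → x ∈ˢ zs) → count P? xs ≤ length zs
  count≤length P? {xs} uniq zs P⊆zs = ≤-trans (≤-reflexive (sym (length-filter P? xs)))
    (unique⇒length≤ zs (UniqueSetoidₚ.filter⁺ S P? uniq) (All.map (P⊆zs _) (All.all-filter P? xs)))

  -- f maps P to Q, and pre lists its fibres.
  count-fibres : {P Q : Carrier → Set} (P? : Decidable P) (Q? : Decidable Q) {xs : List Carrier} → Uniqueˢ xs →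
      (∀ x → x ∈ˢ xs) →
                 (f : Carrier → Carrier) (pre : Carrier → List Carrier) (D : ℕ) → (∀ y → length (pre y) ≤ D) →
                 (∀ x y → P x → f x ≈ y → Q y × x ∈ˢ pre y) →
                 count P? xs ≤ D * count Q? xs
  count-fibres P? Q? {xs} uniq complete f pre D bound step = begin
    count P? xs                            ≤⟨ count≤length P? uniq (concatMap pre (filter Q? xs)) covered ⟩
    length (concatMap pre (filter Q? xs))  ≤⟨ length-concatMap-≤ pre D bound (filter Q? xs) ⟩
    D * length (filter Q? xs)              ≡⟨ cong (D *_) (length-filter Q? xs) ⟩
    D * count Q? xs                        ∎
    where
    open ≤-Reasoning
    covered : ∀ x → _ → x ∈ˢ concatMap pre (filter Q? xs)
    covered x px with y , y∈ , fx≈y ← find (complete (f x)) with qy , x∈ ← step x y px fx≈y =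
      Membershipₚ.∈-concatMap⁺ S S (lose (∈-filter⁺ Q? y∈ qy) x∈)

-- The sum is regrouped by the value of `f`, with `D y` bounding the `c`-weight of the fibre over
-- `y`. It serves to count moves between colourings by their results.
∑-fibres : (_≟B_ : DecidableEquality B) (xs : List A) {ys : List B} → (∀ y → y ∈ ys) →
           (c : A → ℕ) (f : A → B) (D g : B → ℕ) →
           (∀ y → ∑ xs (λ x → c x * 𝟙 (f x ≟B y)) ≤ D y) →
           ∑ xs (λ x → c x * g (f x)) ≤ ∑ ys (λ y → D y * g y)
∑-fibres _≟B_ xs {ys} complete c f D g bound = begin
  ∑ xs (λ x → c x * g (f x))                               ≤⟨ ∑-mono xs spread ⟩
  ∑ xs (λ x → ∑ ys (λ y → c x * 𝟙 (f x ≟B y) * g y))       ≡⟨ ∑-swap xs ys _ ⟩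
  ∑ ys (λ y → ∑ xs (λ x → c x * 𝟙 (f x ≟B y) * g y))       ≡⟨ ∑-cong ys (λ y → ∑-*ʳ xs (g y) _) ⟩
  ∑ ys (λ y → ∑ xs (λ x → c x * 𝟙 (f x ≟B y)) * g y)       ≤⟨ ∑-mono ys (λ y → *-monoˡ-≤ (g y) (bound y)) ⟩
  ∑ ys (λ y → D y * g y)                                   ∎
  where
  open ≤-Reasoning
  spread : ∀ x → c x * g (f x) ≤ ∑ ys (λ y → c x * 𝟙 (f x ≟B y) * g y)
  spread x = ≤-trans
    (≤-reflexive (cong (_* g (f x)) (trans (sym (*-identityʳ (c x))) (cong (c x *_) (sym (𝟙-yes refl (f x ≟B f x)))))))
    (∈⇒≤∑ (λ y → c x * 𝟙 (f x ≟B y) * g y) (complete (f x)))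

-- Enumerations and decidability

∀[]? : {X : Set} {P : X → Set} {xs : List X} → (∀ x → x ∈ xs) → Decidable P → Dec (∀ x → P x)
∀[]? {xs = xs} complete P? =
  map′ (λ ps x → All.lookup ps (complete x)) (λ f → All.tabulate λ {x} _ → f x) (All.all? P? xs)

vecs : {X : Set} → List X → ∀ r → List (Vec X r)
vecs xs zero    = [] ∷ []
vecs xs (suc r) = cartesianProductWith _∷_ xs (vecs xs r)

vecs-complete : {X : Set} {xs : List X} → (∀ x → x ∈ xs) → ∀ {r} (v : Vec X r) → v ∈ vecs xs r
vecs-complete complete []      = here refl
vecs-complete complete (x ∷ v) = ∈-cartesianProductWith⁺ _∷_ (complete x) (vecs-complete complete v)

vecs-unique : {X : Set} {xs : List X} → Unique xs → ∀ r → Unique (vecs xs r)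
vecs-unique uniq zero    = [] ∷ []
vecs-unique uniq (suc r) = Unique.cartesianProductWith⁺ _∷_ ∷-injective uniq (vecs-unique uniq r)

length-cartesianProductWith : {X Y Z : Set} (f : X → Y → Z) (xs : List X) (ys : List Y) →
                              length (cartesianProductWith f xs ys) ≡ length xs * length ys
length-cartesianProductWith f []       ys = refl
length-cartesianProductWith f (x ∷ xs) ys = trans (List.length-++ (List.map (f x) ys))
  (cong₂ _+_ (List.length-map (f x) ys) (length-cartesianProductWith f xs ys))

length-vecs : {X : Set} (xs : List X) (r : ℕ) → length (vecs xs r) ≡ length xs ^ r
length-vecs xs zero    = refl
length-vecs xs (suc r) = trans (length-cartesianProductWith _∷_ xs (vecs xs r)) (cong (length xs *_) (length-vecs xs r))

length-allFin : ∀ n → length (allFin n) ≡ n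
length-allFin n = List.length-tabulate id

abstract
  tuples : ∀ n r → List (Vec (Fin n) r)
  tuples n = vecs (allFin n)

  tuples-complete : ∀ {n r} (a : Vec (Fin n) r) → a ∈ tuples n r
  tuples-complete = vecs-complete ∈-allFin

  tuples-unique : ∀ n r → Unique (tuples n r)
  tuples-unique n = vecs-unique (Unique.allFin⁺ n)

  length-tuples : ∀ n r → length (tuples n r) ≡ n ^ r
  length-tuples n r = trans (length-vecs (allFin n) r) (cong (_^ r) (length-allFin n))

∀Vec? : ∀ {n r} {P : Vec (Fin n) r → Set} → Decidable P → Dec (∀ a → P a)
∀Vec? = ∀[]? tuples-complete

sections : ∀ {ρ} {A : Fin ρ → Set} → (∀ k → List (A k)) → List (∀ k → A k)
sections {zero}      xs = (λ ()) ∷ []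
sections {suc ρ} {A} xs = cartesianProductWith cons (xs zero) (sections (xs ∘ suc))
  where
  cons : A zero → (∀ k → A (suc k)) → ∀ k → A k
  cons a f zero    = a
  cons a f (suc k) = f k

-- Functions are compared pointwise only, so membership in the list is weakened to agreement at each
-- `k` in the sense of `P`.
sections-complete : ∀ {ρ} {A : Fin ρ → Set} (P : ∀ k → A k → Set) (xs : ∀ k → List (A k)) →
                    (∀ k → Any (P k) (xs k)) → Any (λ g → ∀ k → P k (g k)) (sections xs)
sections-complete {zero}  P xs ps = here λ ()
sections-complete {suc ρ} P xs ps = Any.cartesianProductWith⁺ _ (λ p q → λ where zero → p ; (suc k) → q k)
  (ps zero) (sections-complete (P ∘ suc) (xs ∘ suc) (ps ∘ suc))

tables : ∀ n r → List (Vec (Fin n) r → Bool)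
tables n zero    = (λ _ → false) ∷ (λ _ → true) ∷ []
tables n (suc r) = List.map (λ g → λ where (x ∷ a) → g x a) (sections {n} λ _ → tables n r)

tables-complete : ∀ n r (f : Vec (Fin n) r → Bool) → Any (λ g → ∀ a → f a ≡ g a) (tables n r)
tables-complete n zero f with f [] in eq
... | false = here λ where [] → eq
... | true  = there (here λ where [] → eq)
tables-complete n (suc r) f = Any.map⁺ (Any.map (λ p → λ where (x ∷ a) → p x a)
  (sections-complete (λ x g → ∀ a → f (x ∷ a) ≡ g a) _ λ x → tables-complete n r λ a → f (x ∷ a)))

permutations : ∀ r → List (Permutation′ r)
permutations zero    = Perm.id ∷ []
permutations (suc r) = cartesianProductWith (Perm.insert zero) (allFin (suc r)) (permutations r)

-- A permutation is determined by the image of `zero` and by what remains after removing `zero` and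
-- that image.
permutations-complete : ∀ {r} (π : Permutation′ r) → Any (λ σ → ∀ i → π ⟨$⟩ʳ i ≡ σ ⟨$⟩ʳ i) (permutations r)
permutations-complete {zero}  π = here λ ()
permutations-complete {suc r} π = Any.cartesianProductWith⁺ (Perm.insert zero) combine
  (∈-allFin (π ⟨$⟩ʳ zero)) (permutations-complete (Perm.remove zero π))
  where
  combine : ∀ {j σ} → π ⟨$⟩ʳ zero ≡ j → (∀ i → Perm.remove zero π ⟨$⟩ʳ i ≡ σ ⟨$⟩ʳ i) →
            ∀ i → π ⟨$⟩ʳ i ≡ Perm.insert zero j σ ⟨$⟩ʳ i
  combine refl eq zero    = refl
  combine {σ = σ} refl eq (suc i) = begin
    π ⟨$⟩ʳ suc i                                                ≡⟨ Perm.punchIn-permute π zero i ⟩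
    Fin.punchIn (π ⟨$⟩ʳ zero) (Perm.remove zero π ⟨$⟩ʳ i)       ≡⟨ cong (Fin.punchIn (π ⟨$⟩ʳ zero)) (eq i) ⟩
    Fin.punchIn (π ⟨$⟩ʳ zero) (σ ⟨$⟩ʳ i)                        ≡⟨ Perm.insert-punchIn zero (π ⟨$⟩ʳ zero) σ i ⟨
    Perm.insert zero (π ⟨$⟩ʳ zero) σ ⟨$⟩ʳ suc i                 ∎
    where open ≡-Reasoning

-- Transpositions, permuted tuples and rainbow tuples

swap-other : ∀ {n} (a b : Fin n) {x} → x ≢ a → x ≢ b → Perm.transpose a b ⟨$⟩ʳ x ≡ x
swap-other a b {x} x≢a x≢b with x Fin.≟ a
... | yes x≡a = contradiction x≡a x≢a
... | no _ with x Fin.≟ b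
...   | yes x≡b = contradiction x≡b x≢b
...   | no _    = refl

swap-left : ∀ {n} (a b : Fin n) → Perm.transpose a b ⟨$⟩ʳ a ≡ b
swap-left a b with a Fin.≟ a
... | yes _  = refl
... | no a≢a = contradiction refl a≢a

swap-right : ∀ {n} (a b : Fin n) → Perm.transpose a b ⟨$⟩ʳ b ≡ a
swap-right a b with b Fin.≟ a
... | yes b≡a = b≡a
... | no _ with b Fin.≟ b
...   | yes _  = refl
...   | no b≢b = contradiction refl b≢b

module _ {X : Set} {r : ℕ} where

  permute : Permutation′ r → Vec X r → Vec X r
  permute π a = tabulate λ i → lookup a (π ⟨$⟩ʳ i)

  lookup-permute : ∀ π a i → lookup (permute π a) i ≡ lookup a (π ⟨$⟩ʳ i)
  lookup-permute π a i = lookup∘tabulate _ i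

  permute-flip : ∀ π a → permute (flip π) (permute π a) ≡ a
  permute-flip π a = trans
    (tabulate-cong λ i → trans (lookup-permute π a _) (cong (lookup a) (Perm.inverseʳ π)))
    (tabulate∘lookup a)

  occurs-permute : ∀ {v} π a → (∃ λ p → lookup a p ≡ v) → ∃ λ p → lookup (permute π a) p ≡ v
  occurs-permute π a (p , eq) =
    π ⟨$⟩ˡ p , trans (lookup-permute π a _) (trans (cong (lookup a) (Perm.inverseʳ π)) eq)

  occurs-unpermute : ∀ {v} π a → (∃ λ p → lookup (permute π a) p ≡ v) → ∃ λ p → lookup a p ≡ v
  occurs-unpermute π a (p , eq) = π ⟨$⟩ʳ p , trans (sym (lookup-permute π a p)) eq

map-permute : {X Y : Set} {r : ℕ} (f : X → Y) (π : Permutation′ r) (a : Vec X r) →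
              map f (permute π a) ≡ permute π (map f a)
map-permute f π a = trans (sym (tabulate-∘ f _)) (tabulate-cong λ i → sym (lookup-map (π ⟨$⟩ʳ i) f a))

lookup-ext : {X : Set} {r : ℕ} {a b : Vec X r} → (∀ i → lookup a i ≡ lookup b i) → a ≡ b
lookup-ext eq = trans (sym (tabulate∘lookup _)) (trans (tabulate-cong eq) (tabulate∘lookup _))

Rainbow : {l r : ℕ} {X : Set} → (X → Fin l) → Vec X r → Set
Rainbow γ a = ∀ i j → i ≢ j → γ (lookup a i) ≢ γ (lookup a j)

rainbow? : {l r : ℕ} {X : Set} (γ : X → Fin l) (a : Vec X r) → Dec (Rainbow γ a)
rainbow? γ a = Fin.all? λ i → Fin.all? λ j → ¬? (i Fin.≟ j) →-dec ¬? (γ (lookup a i) Fin.≟ γ (lookup a j))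

rainbow-permute : ∀ {l r} {X : Set} (γ : X → Fin l) (π : Permutation′ r) (a : Vec X r) →
                  Rainbow γ a → Rainbow γ (permute π a)
rainbow-permute γ π a rainbow i j i≢j eq = rainbow (π ⟨$⟩ʳ i) (π ⟨$⟩ʳ j) (i≢j ∘ injective)
  (trans (cong γ (sym (lookup-permute π a i))) (trans eq (cong γ (lookup-permute π a j))))
  where
  injective : π ⟨$⟩ʳ i ≡ π ⟨$⟩ʳ j → i ≡ j
  injective p = trans (sym (Perm.inverseˡ π)) (trans (cong (π ⟨$⟩ˡ_) p) (Perm.inverseˡ π))

rainbow-map : ∀ {l r} {X Y : Set} (γ : Y → Fin l) (δ : X → Fin l) (f : X → Y) → (∀ x → γ (f x) ≡ δ x) →
              (a : Vec X r) → (Rainbow δ a → Rainbow γ (map f a)) × (Rainbow γ (map f a) → Rainbow δ a)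
rainbow-map γ δ f eq a = (λ rb i j i≢j e → rb i j i≢j (trans (sym (at i)) (trans e (at j)))) ,
                                   (λ rb i j i≢j e → rb i j i≢j (trans (at i) (trans e (sym (at j)))))
  where
  at : ∀ i → γ (lookup (map f a) i) ≡ δ (lookup a i)
  at i = trans (cong γ (lookup-map i f a)) (eq (lookup a i))

-- Finite structures, satisfaction and coloured pairs

module Structures (L : Vocabulary) where

  module _ {n : ℕ} where
    open Setoid (structureSetoid L n) public using () renaming (refl to ≈-refl; sym to ≈-sym; trans to ≈-trans)

    infix 4 _∈ˢ_
    _∈ˢ_ : Structure L n → List (Structure L n) → Set
    _∈ˢ_ = Membership._∈_ (structureSetoid L n)

    Respects : (Structure L n → Set) → Set
    Respects P = ∀ {M N} → M ≈ₛ N → P M → P N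

    _≈ₛ?_ : (M N : Structure L n) → Dec (M ≈ₛ N)
    M ≈ₛ? N = Fin.all? λ k → ∀Vec? λ a → interp M k a Bool.≟ interp N k a

  abstract
    structures : ∀ n → List (Structure L n)
    structures n = List.deduplicate _≈ₛ?_
      (List.map (λ f → record { interp = f }) (sections λ k → tables n (arity L k)))

    structures-unique : ∀ n → UniqueSetoid.Unique (structureSetoid L n) (structures n)
    structures-unique n = UniqueDecSetoid.deduplicate-!
      (record { isDecEquivalence = record { isEquivalence = Setoid.isEquivalence (structureSetoid L n) ; _≟_ = _≈ₛ?_ }
          }) _

    structures-complete : ∀ {n} (M : Structure L n) → M ∈ˢ structures n
    structures-complete {n} M = Membershipₚ.∈-deduplicate⁺ (structureSetoid L n) _≈ₛ?_
      (λ z≈y x≈z → ≈-trans x≈z (≈-sym z≈y))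
      (Any.map⁺ (sections-complete (λ k g → ∀ a → interp M k a ≡ g a) _ λ k → tables-complete n _ (interp M k)))

  -- The atomic type of the tuple `e` in `M`, encoded as a structure on the index set of `e`.
  pull : ∀ {m n} → Vec (Fin n) m → Structure L n → Structure L m
  pull e M = record { interp = λ k a → interp M k (map (lookup e) a) }

  ⊨-resp : ∀ {n m} {M N : Structure L n} (φ : Formula L m) (e : Vec (Fin n) m) → M ≈ₛ N → M ⊨ φ [ e ] → N ⊨ φ [ e ]
  ⊨-resp (x ≐ y)   e M≈N p        = p
  ⊨-resp (rel k t) e M≈N p        = trans (sym (M≈N k _)) p
  ⊨-resp (¬′ φ)    e M≈N p        = λ q → p (⊨-resp φ e (≈-sym M≈N) q)
  ⊨-resp (φ ∧′ ψ)  e M≈N (p , q)  = ⊨-resp φ e M≈N p , ⊨-resp ψ e M≈N q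
  ⊨-resp (φ ∨′ ψ)  e M≈N (inj₁ p) = inj₁ (⊨-resp φ e M≈N p)
  ⊨-resp (φ ∨′ ψ)  e M≈N (inj₂ p) = inj₂ (⊨-resp ψ e M≈N p)
  ⊨-resp (φ ⇒′ ψ)  e M≈N p        = λ q → ⊨-resp ψ e M≈N (p (⊨-resp φ e (≈-sym M≈N) q))
  ⊨-resp (∀′ φ)    e M≈N p        = λ a → ⊨-resp φ (a ∷ e) M≈N (p a)
  ⊨-resp (∃′ φ)    e M≈N (a , p)  = a , ⊨-resp φ (a ∷ e) M≈N p

  _⊨?_[_] : ∀ {n m} (M : Structure L n) (φ : Formula L m) (e : Vec (Fin n) m) → Dec (M ⊨ φ [ e ])
  M ⊨? x ≐ y   [ e ] = lookup e x Fin.≟ lookup e y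
  M ⊨? rel k t [ e ] = interp M k _ Bool.≟ true
  M ⊨? ¬′ φ    [ e ] = ¬? (M ⊨? φ [ e ])
  M ⊨? φ ∧′ ψ  [ e ] = (M ⊨? φ [ e ]) ×-dec (M ⊨? ψ [ e ])
  M ⊨? φ ∨′ ψ  [ e ] = (M ⊨? φ [ e ]) ⊎-dec (M ⊨? ψ [ e ])
  M ⊨? φ ⇒′ ψ  [ e ] = (M ⊨? φ [ e ]) →-dec (M ⊨? ψ [ e ])
  M ⊨? ∀′ φ    [ e ] = Fin.all? λ a → M ⊨? φ [ a ∷ e ]
  M ⊨? ∃′ φ    [ e ] = Fin.any? λ a → M ⊨? φ [ a ∷ e ]

module Coloured (l : ℕ) (L : Vocabulary) (I : Subset (ρ L)) where

  open Structures L public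

  -- Vectors instead of functions: they have decidable equality and can be listed without
  -- repetition.
  Colouring : ℕ → Set
  Colouring n = Vec (Fin l) n

  colourings : ∀ n → List (Colouring n)
  colourings = tuples l

  _≟ᶜ_ : ∀ {n} → DecidableEquality (Colouring n)
  _≟ᶜ_ = Vec.≡-dec Fin._≟_

  abstract
    strongColouring? : ∀ {n} (M : Structure L n) (γ : Fin n → Fin l) → Dec (StrongColouring l M γ)
    strongColouring? M γ = Fin.all? λ k → ∀Vec? λ a → (interp M k a Bool.≟ true) →-dec rainbow? γ a

  SymmetricOn : ∀ {n} → Structure L n → Set
  SymmetricOn M = ∀ k → k Subset.∈ I → SymmetricAt M k

  abstract
    symmetricAt? : ∀ {n} (M : Structure L n) k → Dec (SymmetricAt M k)
    symmetricAt? M k = map′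
      (λ ps π a h → let σ , _ , ps , eq = find′ (permutations-complete π) ps
                    in subst (Holds M k) (tabulate-cong λ i → cong (lookup a) (sym (eq i))) (ps a h))
      (λ sym → All.tabulate λ {π} _ → sym π)
      (All.all? (λ π → ∀Vec? λ a → (interp M k a Bool.≟ true) →-dec (interp M k (permute π a) Bool.≟ true))
                (permutations (arity L k)))
      where
      find′ : ∀ {X : Set} {P Q : X → Set} {xs} → Any P xs → All Q xs → ∃ λ x → x ∈ xs × Q x × P x
      find′ p q with x , x∈ , px ← find p = x , x∈ , All.lookup q x∈ , px

  infix 4 _◂_
  -- Pairwise different colours force distinct entries, so a strong colouring together with symmetry
  -- on `I` yields membership in `InS`.
  _◂_ : ∀ {n} → Colouring n → Structure L n → Set
  γ ◂ M = StrongColouring l M (lookup γ) × SymmetricOn M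

  abstract
    _◂?_ : ∀ {n} (γ : Colouring n) (M : Structure L n) → Dec (γ ◂ M)
    γ ◂? M = strongColouring? M (lookup γ) ×-dec Fin.all? λ k → (k Subset.∈? I) →-dec symmetricAt? M k

  ◂-resp : ∀ {n} (γ : Colouring n) → Respects (γ ◂_)
  ◂-resp γ M≈N (col , sy) = (λ k a h → col k a (trans (M≈N k a) h)) ,
                            (λ k k∈I π a h → trans (sym (M≈N k _)) (sy k k∈I π a (trans (M≈N k a) h)))

  strongColouring-tabulate : ∀ {n} {M : Structure L n} {γ : Fin n → Fin l} →
                             StrongColouring l M γ → StrongColouring l M (lookup (tabulate γ))
  strongColouring-tabulate {γ = γ} col k a h i j i≢j eq =
    col k a h i j i≢j (trans (sym (lookup∘tabulate γ _)) (trans eq (lookup∘tabulate γ _)))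

  inS⇒◂ : ∀ {n} {M : Structure L n} → InS l I M → ∃ λ γ → γ ◂ M
  inS⇒◂ ((γ , col) , sy) = tabulate γ , strongColouring-tabulate col , λ k k∈I → proj₂ (sy k k∈I)

  ◂⇒inS : ∀ {n} {M : Structure L n} γ → γ ◂ M → InS l I M
  ◂⇒inS γ (col , sy) = (lookup γ , col) , λ k k∈I → (λ a h → irreflexive a (col k a h)) , sy k k∈I
    where
    irreflexive : ∀ {r} (a : Vec _ r) → Rainbow (lookup γ) a → VecUnique.Unique a
    irreflexive a rainbow = subst VecUnique.Unique (tabulate∘lookup a) (VecUnique.tabulate⁺ λ {i} {j} eq →
      decidable-stable (i Fin.≟ j) λ i≢j → rainbow i j i≢j (cong (lookup γ) eq))

  abstract
    inS? : ∀ {n} (M : Structure L n) → Dec (InS l I M)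
    inS? {n} M = map′ (λ p → let γ , _ , h = find p in ◂⇒inS γ h)
                      (λ s → let γ , h = inS⇒◂ s in lose (tuples-complete γ) h)
                      (Any.any? (_◂? M) (colourings n))

  inS-resp : ∀ {n} → Respects {n} (InS l I)
  inS-resp M≈N s = let γ , h = inS⇒◂ s in ◂⇒inS γ (◂-resp γ M≈N h)

  pull-◂ : ∀ {m n} {M : Structure L n} {γ : Colouring n} (e : Vec (Fin n) m) → γ ◂ M → map (lookup γ) e ◂ pull e M
  pull-◂ {M = M} {γ} e (col , sy) =
    (λ k a h → proj₂ (rainbow-map (lookup γ) (lookup (map (lookup γ) e)) (lookup e)
        (λ x → sym (lookup-map x (lookup γ) e)) a) (col k _ h)) ,
    (λ k k∈I π a h → trans (cong (interp M k) (map-permute (lookup e) π a)) (sy k k∈I π _ h))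

-- Extension properties

lookup-transfer : ∀ {X Y : Set} {m r} {d : Vec X m} {e : Vec Y m} →
    (∀ i j → lookup d i ≡ lookup d j → lookup e i ≡ lookup e j) →
                  (t t′ : Vec (Fin m) r) → map (lookup d) t ≡ map (lookup d) t′ → map (lookup e) t ≡ map (lookup e) t′
lookup-transfer {d = d} {e} σ t t′ eq = lookup-ext λ i → trans (lookup-map i (lookup e) t)
  (trans (σ _ _ (trans (sym (lookup-map i (lookup d) t))
      (trans (cong (λ u → lookup u i) eq) (lookup-map i (lookup d) t′))))
         (sym (lookup-map i (lookup e) t′)))

locate : ∀ {n m r} (e : Vec (Fin n) m) (a : Vec (Fin n) r) → Dec (∃ λ b → map (lookup e) b ≡ a)
locate e []      = yes ([] , refl)
locate e (x ∷ a) with Fin.any? (λ i → lookup e i Fin.≟ x) | locate e a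
... | yes (i , refl) | yes (b , refl) = yes (i ∷ b , refl)
... | no ¬i          | _              = no λ where (i ∷ b , refl) → ¬i (i , refl)
... | yes _          | no ¬b          = no λ where (i ∷ b , refl) → ¬b (b , refl)

Avoids : ∀ {n m} → Fin n → Vec (Fin n) m → Set
Avoids v e = ∀ i → lookup e i ≢ v

-- A model of `v ∷ e` for any `v` that avoids `e`: the coincidences among its entries are those of
-- `e` plus one new entry, independently of `v`.
fresh : ∀ {n m} → Vec (Fin n) m → Vec (Fin (suc n)) (suc m)
fresh e = zero ∷ map suc e

lower-vec : ∀ {m r} (b : Vec (Fin (suc m)) r) → (∀ i → lookup b i ≢ zero) → ∃ λ b′ → b ≡ map suc b′
lower-vec []           nz = [] , refl
lower-vec (zero ∷ b)   nz = contradiction refl (nz zero)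
lower-vec (suc x ∷ b)  nz with b′ , refl ← lower-vec b (nz ∘ suc) = x ∷ b′ , refl

module Extension (l : ℕ) (L : Vocabulary) (I : Subset (ρ L)) where

  open Coloured l L I public

  -- The tuple e may have repetitions; Q is then the pullback along e of a structure on the entries of e.
  Kernel : ∀ {n m} → Vec (Fin n) m → Structure L m → Set
  Kernel e Q = ∀ k t t′ → map (lookup e) t ≡ map (lookup e) t′ → interp Q k t ≡ interp Q k t′

  overwrite : ∀ {n m} → Structure L n → Vec (Fin n) m → Structure L m → Structure L n
  overwrite {n} {m} M e Q = record { interp = λ k a → choose (interp Q k) (interp M k a) (locate e a) }
    where
    choose : ∀ {r} {a : Vec (Fin n) r} → (Vec (Fin m) r → Bool) → Bool → Dec (∃ λ b → map (lookup e) b ≡ a) → Bool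
    choose q d (yes (b , _)) = q b
    choose q d (no _)        = d

  module _ {n m} (M : Structure L n) (e : Vec (Fin n) m) (Q : Structure L m) where

    overwrite-inside : Kernel e Q → ∀ k b → interp (overwrite M e Q) k (map (lookup e) b) ≡ interp Q k b
    overwrite-inside ker k b with locate e (map (lookup e) b)
    ... | yes (b′ , eq) = ker k b′ b eq
    ... | no ¬b         = contradiction (b , refl) ¬b

    overwrite-outside : ∀ k {a} → ¬ (∃ λ b → map (lookup e) b ≡ a) → interp (overwrite M e Q) k a ≡ interp M k a
    overwrite-outside k {a} ¬b with locate e a
    ... | yes b = contradiction b ¬b
    ... | no _  = refl

    -- The tuples with all entries in `e` are closed under permutation, and so is their complement.
    -- Hence symmetry and colouring are inherited from `Q` inside and from `M` outside.
    overwrite-◂ : (γ : Colouring n) → γ ◂ M → map (lookup γ) e ◂ Q → Kernel e Q → γ ◂ overwrite M e Q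
    overwrite-◂ γ (colM , symM) (colQ , symQ) ker = col , sy
      where
      col : StrongColouring l (overwrite M e Q) (lookup γ)
      col k a h with locate e a
      ... | yes (b , refl) = proj₁ (rainbow-map (lookup γ) (lookup (map (lookup γ) e)) (lookup e)
                                      (λ x → sym (lookup-map x (lookup γ) e)) b) (colQ k b h)
      ... | no ¬b          = colM k a h

      sy : SymmetricOn (overwrite M e Q)
      sy k k∈I π a h with locate e a
      ... | yes (b , refl) = trans (cong (interp (overwrite M e Q) k) (sym (map-permute (lookup e) π b)))
                                   (trans (overwrite-inside ker k (permute π b)) (symQ k k∈I π b h))
      ... | no ¬b          = trans (overwrite-outside k outside) (symM k k∈I π a h)
        where
        outside : ¬ (∃ λ b → map (lookup e) b ≡ permute π a)
        outside (b , eq) = ¬b (permute (flip π) b ,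
          trans (map-permute (lookup e) (flip π) b) (trans (cong (permute (flip π)) eq) (permute-flip π a)))

  -- Index `zero` of `Q` is the new vertex. The condition relating `Q` to `M` is kept apart in
  -- `Agrees`, so that a pattern can be fixed before the structures `M` are counted.
  IsPattern : ∀ {n m} → Colouring n → Vec (Fin n) m → Fin l → Structure L (suc m) → Set
  IsPattern γ e c Q = (c ∷ map (lookup γ) e) ◂ Q × Kernel (fresh e) Q

  Agrees : ∀ {n m} → Structure L n → Vec (Fin n) m → Structure L (suc m) → Set
  Agrees M e Q = ∀ k t → interp Q k (map suc t) ≡ interp M k (map (lookup e) t)

  candidate? : ∀ {n m} (γ : Colouring n) (c : Fin l) (e : Vec (Fin n) m) (v : Fin n) → Dec (lookup γ v ≡ c × Avoids v e)
  candidate? γ c e v = (lookup γ v Fin.≟ c) ×-dec Fin.all? λ i → ¬? (lookup e i Fin.≟ v)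

  candidates : ∀ {n m} → Colouring n → Fin l → Vec (Fin n) m → List (Fin n)
  candidates {n} γ c e = filter (candidate? γ c e) (allFin n)

  Realises : ∀ {n m} → Structure L n → Vec (Fin n) m → Structure L (suc m) → Fin n → Set
  Realises M e Q v = pull (v ∷ e) M ≈ₛ Q

  Extends : ∀ {n m} → Structure L n → Colouring n → Vec (Fin n) m → Fin l → Structure L (suc m) → Set
  Extends M γ e c Q = IsPattern γ e c Q → Agrees M e Q → Any (Realises M e Q) (candidates γ c e)

  abstract
    isPattern? : ∀ {n m} (γ : Colouring n) (e : Vec (Fin n) m) c Q → Dec (IsPattern γ e c Q)
    isPattern? γ e c Q = ((c ∷ map (lookup γ) e) ◂? Q) ×-dec
      Fin.all? λ k → ∀Vec? λ t → ∀Vec? λ t′ →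
        Vec.≡-dec Fin._≟_ (map (lookup (fresh e)) t) (map (lookup (fresh e)) t′) →-dec
            (interp Q k t Bool.≟ interp Q k t′)

  abstract
    agrees? : ∀ {n m} (M : Structure L n) (e : Vec (Fin n) m) Q → Dec (Agrees M e Q)
    agrees? M e Q = Fin.all? λ k → ∀Vec? λ t → interp Q k (map suc t) Bool.≟ interp M k (map (lookup e) t)

  abstract
    realises? : ∀ {n m} (M : Structure L n) (e : Vec (Fin n) m) Q v → Dec (Realises M e Q v)
    realises? M e Q v = pull (v ∷ e) M ≈ₛ? Q

  abstract
    extends? : ∀ {n m} (M : Structure L n) (γ : Colouring n) (e : Vec (Fin n) m) c Q → Dec (Extends M γ e c Q)
    extends? M γ e c Q = isPattern? γ e c Q →-dec (agrees? M e Q →-dec Any.any? (realises? M e Q) (candidates γ c e))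

  -- Testing only the listed structures makes the property decidable; `ext⇒` reaches any `Q` through
  -- its listed representative.
  Ext : ∀ {n} → ℕ → Structure L n → Colouring n → Set
  Ext {n} m M γ = ∀ (e : Vec (Fin n) m) c → All (Extends M γ e c) (structures (suc m))

  abstract
    ext? : ∀ {n} m (M : Structure L n) (γ : Colouring n) → Dec (Ext m M γ)
    ext? m M γ = ∀Vec? λ e → Fin.all? λ c → All.all? (extends? M γ e c) (structures (suc m))

  realises-resp : ∀ {n m} {M N : Structure L n} (e : Vec (Fin n) m) {Q} {v} → M ≈ₛ N → Realises M e Q v →
      Realises N e Q v
  realises-resp e M≈N r k t = trans (sym (M≈N k _)) (r k t)

  ext-resp : ∀ {n} m (γ : Colouring n) → Respects (λ M → Ext m M γ)
  ext-resp m γ M≈N ext e c = All.map (λ ex pat agr →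
    Any.map (realises-resp e M≈N) (ex pat (λ k t → trans (agr k t) (sym (M≈N k _))))) (ext e c)

  ext⇒ : ∀ {n m} {M : Structure L n} {γ : Colouring n} → Ext m M γ → (e : Vec (Fin n) m) (c : Fin l)
      (Q : Structure L (suc m)) →
         IsPattern γ e c Q → Agrees M e Q → ∃ λ v → lookup γ v ≡ c × Avoids v e × Realises M e Q v
  ext⇒ {M = M} {γ} ext e c Q ((col , sy) , ker) agr with Q′ , Q′∈ , Q≈Q′ ← find (structures-complete Q)
    with v , v∈ , real ← find (All.lookup (ext e c) Q′∈
           (◂-resp (c ∷ map (lookup γ) e) Q≈Q′ (col , sy) , λ k t t′ eq → trans (sym (Q≈Q′ k t))
               (trans (ker k t t′ eq) (Q≈Q′ k t′)))
           (λ k t → trans (sym (Q≈Q′ k _)) (agr k t)))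
    with _ , γv≡c , avoids ← ∈-filter⁻ (candidate? γ c e) {xs = allFin _} v∈ =
    v , γv≡c , avoids , λ k t → trans (real k t) (sym (Q≈Q′ k t))

  module _ {n m : ℕ} (γ : Colouring n) (e : Vec (Fin n) m) (c : Fin l) (Q : Structure L (suc m)) where

    Missed : List (Fin n) → Structure L n → Set
    Missed vs M = γ ◂ M × Agrees M e Q × ¬ Any (Realises M e Q) vs

    missed? : ∀ vs M → Dec (Missed vs M)
    missed? vs M = (γ ◂? M) ×-dec (agrees? M e Q ×-dec ¬? (Any.any? (realises? M e Q) vs))

    module _ (pattern-Q : IsPattern γ e c Q) where
      private
        kernel⁺ : ∀ {v} → Avoids v e → Kernel (v ∷ e) Q
        kernel⁺ {v} avoids k t t′ eq = proj₂ pattern-Q k t t′ (lookup-transfer {d = v ∷ e} {fresh e} σ t t′ eq)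
          where
          σ : ∀ i j → lookup (v ∷ e) i ≡ lookup (v ∷ e) j → lookup (fresh e) i ≡ lookup (fresh e) j
          σ zero    zero    p = refl
          σ zero    (suc j) p = contradiction (sym p) (avoids j)
          σ (suc i) zero    p = contradiction p (avoids i)
          σ (suc i) (suc j) p = trans (lookup-map i suc e) (trans (cong suc p) (sym (lookup-map j suc e)))

      -- Overwriting M at v ∷ e does not change the types over e of the other vertices.
      missed-switch : ∀ {v vs} → lookup γ v ≡ c → Avoids v e → v ∉ vs →
                      count (missed? vs) (structures n) ≤
                      suc (length (structures (suc m))) * count (λ M → missed? vs M ×-dec realises? M e Q v)
                          (structures n)
      missed-switch {v} {vs} refl avoids v∉vs = count-fibres (structureSetoid L n) (missed? vs)
          (λ M → missed? vs M ×-dec realises? M e Q v) (structures-unique n) structures-complete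
        (λ M → overwrite M (v ∷ e) Q) (λ N → List.map (overwrite N (v ∷ e)) (structures (suc m)))
        -- The fibre bound is raised by one so that `missed-bound` can lose a factor `d / suc d`
        -- without subtraction.
        _ (λ N → ≤-trans (≤-reflexive (List.length-map _ (structures (suc m)))) (n≤1+n _)) step
        where
        ker : Kernel (v ∷ e) Q
        ker = kernel⁺ avoids

        module _ (M N : Structure L n) (missed : Missed vs M) (M′≈N : overwrite M (v ∷ e) Q ≈ₛ N) where
          agrees : Agrees M e Q
          agrees = proj₁ (proj₂ missed)

          realises : Realises N e Q v
          realises k t = trans (sym (M′≈N k _)) (overwrite-inside M (v ∷ e) Q ker k t)

          agrees′ : Agrees N e Q
          agrees′ k t = trans (sym (realises k (map suc t))) (cong (interp N k) (sym (map-∘ (lookup (v ∷ e)) suc t)))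

          avoids-v : ∀ {w} → w ≢ v → Avoids v (w ∷ e)
          avoids-v w≢v zero    = w≢v
          avoids-v w≢v (suc i) = avoids i

          unchanged : ∀ {w} → w ≢ v → ∀ k t → interp M k (map (lookup (w ∷ e)) t) ≡ interp N k (map (lookup (w ∷ e)) t)
          unchanged {w} w≢v k t with locate (v ∷ e) (map (lookup (w ∷ e)) t)
          ... | no ¬b = trans (sym (overwrite-outside M (v ∷ e) Q k ¬b)) (M′≈N k _)
          -- The tuple misses `v`, so it lies in `e` alone, where `M` and `N` both agree with `Q`.
          ... | yes (b , eq) with b′ , refl ← lower-vec b (λ i bi≡0 → avoids-v w≢v (lookup t i)
                 (trans (sym (lookup-map i (lookup (w ∷ e)) t)) (trans (sym (cong (λ u → lookup u i) eq))
                   (trans (lookup-map i (lookup (v ∷ e)) b) (cong (lookup (v ∷ e)) bi≡0))))) = begin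
            interp M k (map (lookup (w ∷ e)) t)         ≡⟨ cong (interp M k) eq′ ⟩
            interp M k (map (lookup e) b′)              ≡⟨ agrees k b′ ⟨
            interp Q k (map suc b′)                     ≡⟨ agrees′ k b′ ⟩
            interp N k (map (lookup e) b′)              ≡⟨ cong (interp N k) eq′ ⟨
            interp N k (map (lookup (w ∷ e)) t)         ∎
            where
            open ≡-Reasoning
            eq′ : map (lookup (w ∷ e)) t ≡ map (lookup e) b′
            eq′ = trans (sym eq) (sym (map-∘ (lookup (v ∷ e)) suc b′))

        step : ∀ M N → Missed vs M → overwrite M (v ∷ e) Q ≈ₛ N →
               (Missed vs N × Realises N e Q v) × M ∈ˢ List.map (overwrite N (v ∷ e)) (structures (suc m))
        step M N missed M′≈N =
          ( ( ◂-resp γ M′≈N (overwrite-◂ M (v ∷ e) Q γ (proj₁ missed) (proj₁ pattern-Q) ker)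
            , agrees′ M N missed M′≈N
            , λ p → proj₂ (proj₂ missed) (missed-back p))
          , realises M N missed M′≈N)
          , Any.map⁺ (Any.map restore (structures-complete (pull (v ∷ e) M)))
          where
          missed-back : Any (Realises N e Q) vs → Any (Realises M e Q) vs
          missed-back p with w , w∈ , real ← find p =
            lose w∈ λ k t → trans (unchanged M N missed M′≈N (λ where refl → v∉vs w∈) k t) (real k t)
          -- `M` is recovered from `N` and the overwritten part of `M`, so each structure on `suc m`
          -- points accounts for at most one element of the fibre.
          restore : ∀ {R} → pull (v ∷ e) M ≈ₛ R → M ≈ₛ overwrite N (v ∷ e) R
          restore M≈R k a with locate (v ∷ e) a
          ... | yes (b , refl) = M≈R k b
          ... | no ¬b          = trans (sym (overwrite-outside M (v ∷ e) Q k ¬b)) (M′≈N k a)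

      -- Let `d` be the number of structures on `suc m` points. Among the structures that miss `vs`,
      -- at least one in `suc d` realises `Q` at the next candidate, by `missed-switch`; so each
      -- candidate contributes a factor `d / suc d`.
      missed-bound : ∀ s {vs} → Unique vs → All (λ v → lookup γ v ≡ c × Avoids v e) vs → s ≤ length vs →
                     suc (length (structures (suc m))) ^ s * count (missed? vs) (structures n) ≤
                     length (structures (suc m)) ^ s * count (γ ◂?_) (structures n)
      missed-bound zero {vs} _ _ _ =
        +-monoˡ-≤ 0 (count-mono (missed? vs) (γ ◂?_) (structures n) (λ _ → proj₁))
      missed-bound (suc s) {v ∷ vs} (v∉ ∷ uniq) ((γv≡c , avoids) ∷ cand) (s≤s s≤) = begin
        suc d * suc d ^ s * x′      ≡⟨ move (suc d) (suc d ^ s) x′ ⟩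
        suc d ^ s * (suc d * x′)    ≤⟨ *-monoʳ-≤ (suc d ^ s) one-step ⟩
        suc d ^ s * (d * x)         ≡⟨ move d (suc d ^ s) x ⟨
        d * suc d ^ s * x           ≡⟨ *-assoc d _ x ⟩
        d * (suc d ^ s * x)         ≤⟨ *-monoʳ-≤ d (missed-bound s uniq cand s≤) ⟩
        d * (d ^ s * w)             ≡⟨ *-assoc d _ w ⟨
        d * d ^ s * w               ∎
        where
        open ≤-Reasoning
        d  = length (structures (suc m))
        x  = count (missed? vs) (structures n)
        x′ = count (missed? (v ∷ vs)) (structures n)
        w  = count (γ ◂?_) (structures n)
        hit  = count (λ M → missed? vs M ×-dec realises? M e Q v) (structures n)
        miss = count (λ M → missed? vs M ×-dec ¬? (realises? M e Q v)) (structures n)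
        move : ∀ a b c → a * b * c ≡ b * (a * c)
        move = solve-∀
        x′≤miss : x′ ≤ miss
        x′≤miss = count-mono (missed? (v ∷ vs)) (λ M → missed? vs M ×-dec ¬? (realises? M e Q v)) (structures n)
          λ M missed → (proj₁ missed , proj₁ (proj₂ missed) , proj₂ (proj₂ missed) ∘ there) , proj₂
              (proj₂ missed) ∘ here
        one-step : suc d * x′ ≤ d * x
        -- The structures that realise `Q` at `v` are added to both sides, in place of a
        -- subtraction.
        one-step = +-cancelʳ-≤ (suc d * hit) _ _ (begin
          suc d * x′ + suc d * hit      ≤⟨ +-monoˡ-≤ _ (*-monoʳ-≤ (suc d) x′≤miss) ⟩
          suc d * miss + suc d * hit    ≡⟨ *-distribˡ-+ (suc d) miss hit ⟨
          suc d * (miss + hit)          ≡⟨ cong (suc d *_)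
              (trans (+-comm miss hit) (count-split (missed? vs) (λ M → realises? M e Q v) (structures n))) ⟩
          x + d * x                     ≤⟨ +-monoˡ-≤ _ (missed-switch γv≡c avoids (λ v∈ → All.lookup v∉ v∈ refl)) ⟩
          suc d * hit + d * x           ≡⟨ +-comm (suc d * hit) _ ⟩
          d * x + suc d * hit           ∎)

-- Small colour classes are rare

-- Describes an exchange of `as` with an unspecified part of `bs`; the rest of `bs` may stay in
-- `bs`.
record Matches {n : ℕ} (π : Permutation′ n) (as bs : List (Fin n)) : Set where
  field
    left  : ∀ {x} → x ∈ as → π ⟨$⟩ʳ x ∈ bs
    right : ∀ {x} → x ∈ bs → π ⟨$⟩ʳ x ∈ as ⊎ π ⟨$⟩ʳ x ∈ bs
    other : ∀ {x} → x ∉ as → x ∉ bs → π ⟨$⟩ʳ x ≡ x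

-- The composition of the transpositions of corresponding entries of the two lists; surplus entries
-- of `bs` stay fixed.
matching : ∀ {n} {as bs : List (Fin n)} → Unique as → Unique bs → (∀ {x} → x ∈ as → x ∉ bs) →
           length as ≤ length bs → ∃ λ π → Matches π as bs
matching []  _  _ _ = Perm.id , record { left = λ () ; right = inj₂ ; other = λ _ _ → refl }
matching {as = a ∷ as} {b ∷ bs} (a∉ ∷ uas) (b∉ ∷ ubs) disjoint (s≤s as≤bs)
  with π , π-matches ← matching uas ubs (λ p q → disjoint (there p) (there q)) as≤bs = σ ,
      record { left = left′ ; right = right′ ; other = other′ }
  where
  open Matches π-matches
  σ = π Perm.∘ₚ Perm.transpose a b
  a∉as : a ∉ as
  a∉as p = All.lookup a∉ p refl
  b∉bs : b ∉ bs
  b∉bs p = All.lookup b∉ p refl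
  at-a : σ ⟨$⟩ʳ a ≡ b
  at-a = trans (cong (Perm.transpose a b ⟨$⟩ʳ_) (other a∉as (λ p → disjoint (here refl) (there p)))) (swap-left a b)
  at-b : σ ⟨$⟩ʳ b ≡ a
  at-b = trans (cong (Perm.transpose a b ⟨$⟩ʳ_) (other (λ p → disjoint (there p) (here refl)) b∉bs)) (swap-right a b)
  keep-as : ∀ {y} → y ∈ as → Perm.transpose a b ⟨$⟩ʳ y ≡ y
  keep-as p = swap-other a b (λ where refl → a∉as p) (λ where refl → disjoint (there p) (here refl))
  keep-bs : ∀ {y} → y ∈ bs → Perm.transpose a b ⟨$⟩ʳ y ≡ y
  keep-bs p = swap-other a b (λ where refl → disjoint (here refl) (there p)) (λ where refl → b∉bs p)
  left′ : ∀ {x} → x ∈ a ∷ as → σ ⟨$⟩ʳ x ∈ b ∷ bs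
  left′ (here refl) = here at-a
  left′ (there p)   = there (subst (_∈ bs) (sym (keep-bs (left p))) (left p))
  right′ : ∀ {x} → x ∈ b ∷ bs → σ ⟨$⟩ʳ x ∈ a ∷ as ⊎ σ ⟨$⟩ʳ x ∈ b ∷ bs
  right′ (here refl) = inj₁ (here at-b)
  right′ (there p) with right p
  ... | inj₁ q = inj₁ (there (subst (_∈ as) (sym (keep-as q)) q))
  ... | inj₂ q = inj₂ (there (subst (_∈ bs) (sym (keep-bs q)) q))
  other′ : ∀ {x} → x ∉ a ∷ as → x ∉ b ∷ bs → σ ⟨$⟩ʳ x ≡ x
  other′ x∉ x∉′ = trans (cong (Perm.transpose a b ⟨$⟩ʳ_) (other (x∉ ∘ there) (x∉′ ∘ there)))
                        (swap-other a b (x∉ ∘ here) (x∉′ ∘ here))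

module Twist {n : ℕ} (v : Fin n) where

  occurs? : ∀ {r} (a : Vec (Fin n) r) → Dec (∃ λ p → lookup a p ≡ v)
  occurs? a = Fin.any? λ p → lookup a p Fin.≟ v

  twist : ∀ {r} → Permutation′ n → Vec (Fin n) r → Vec (Fin n) r
  twist σ a = if does (occurs? a) then map (σ ⟨$⟩ʳ_) a else a

  twist-in : ∀ {r} σ {a : Vec (Fin n) r} → (∃ λ p → lookup a p ≡ v) → twist σ a ≡ map (σ ⟨$⟩ʳ_) a
  twist-in σ {a} occ with occurs? a
  ... | yes _   = refl
  ... | no ¬occ = contradiction occ ¬occ

  twist-out : ∀ {r} σ {a : Vec (Fin n) r} → ¬ (∃ λ p → lookup a p ≡ v) → twist σ a ≡ a
  twist-out σ {a} ¬occ with occurs? a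
  ... | yes occ = contradiction occ ¬occ
  ... | no _    = refl

  twist-permute : ∀ {r} σ (π : Permutation′ r) (a : Vec (Fin n) r) → twist σ (permute π a) ≡ permute π (twist σ a)
  twist-permute σ π a with occurs? a
  ... | yes occ = trans (twist-in σ (occurs-permute π a occ)) (map-permute (σ ⟨$⟩ʳ_) π a)
  ... | no ¬occ = twist-out σ (¬occ ∘ occurs-unpermute π a)

  -- As `σ` fixes `v`, tuples through `v` are sent to tuples through `v`, so both twists take the
  -- same branch.
  untwist : ∀ {r} σ → σ ⟨$⟩ʳ v ≡ v → (a : Vec (Fin n) r) → twist σ (twist (flip σ) a) ≡ a
  untwist σ σv≡v a with occurs? a
  ... | no ¬occ      = twist-out σ ¬occ
  ... | yes (p , eq) = begin
    twist σ (map (σ ⟨$⟩ˡ_) a)              ≡⟨ twist-in σ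
        (p , trans (lookup-map p (σ ⟨$⟩ˡ_) a) (trans (cong (σ ⟨$⟩ˡ_) (trans eq (sym σv≡v))) (Perm.inverseˡ σ))) ⟩
    map (σ ⟨$⟩ʳ_) (map (σ ⟨$⟩ˡ_) a)        ≡⟨ map-∘ (σ ⟨$⟩ʳ_) (σ ⟨$⟩ˡ_) a ⟨
    map (λ x → σ ⟨$⟩ʳ (σ ⟨$⟩ˡ x)) a         ≡⟨ map-cong (λ x → Perm.inverseʳ σ) a ⟩
    map id a                               ≡⟨ Vec.map-id a ⟩
    a                                      ∎
    where open ≡-Reasoning

module Balance (l : ℕ) (L : Vocabulary) (I : Subset (ρ L)) where

  open Extension l L I public

  weight : ∀ {n} → Colouring n → ℕ
  weight {n} γ = count (γ ◂?_) (structures n)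

  class? : ∀ {n} (γ : Colouring n) (i : Fin l) (v : Fin n) → Dec (lookup γ v ≡ i)
  class? γ i v = lookup γ v Fin.≟ i

  classSize : ∀ {n} → Colouring n → Fin l → ℕ
  classSize {n} γ i = count (class? γ i) (allFin n)

  recolour : ∀ {n} → Fin n → Fin l → Colouring n → Colouring n
  recolour v i γ = γ Vec.[ v ]≔ i

  module _ {n : ℕ} (γ : Colouring n) (v : Fin n) (i : Fin l) where
    private
      j  = lookup γ v
      γ′ = recolour v i γ
      rest? : (x : Fin n) → Dec (lookup γ x ≡ j × x ≢ v)
      rest? x = class? γ j x ×-dec ¬? (x Fin.≟ v)
      as = filter (class? γ i) (allFin n)
      bs = filter rest? (allFin n)

      γ′-new : lookup γ′ v ≡ i
      γ′-new = Vec.lookup∘update v γ i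

      γ′-old : ∀ {x} → x ≢ v → lookup γ′ x ≡ lookup γ x
      γ′-old x≢v = Vec.lookup∘update′ x≢v γ i

      ∈as : ∀ {x} → lookup γ x ≡ i → x ∈ as
      ∈as = ∈-filter⁺ (class? γ i) (∈-allFin _)

      as∋ : ∀ {x} → x ∈ as → lookup γ x ≡ i
      as∋ = proj₂ ∘ ∈-filter⁻ (class? γ i) {xs = allFin n}

      ∈bs : ∀ {x} → lookup γ x ≡ j → x ≢ v → x ∈ bs
      ∈bs γx≡j x≢v = ∈-filter⁺ rest? (∈-allFin _) (γx≡j , x≢v)

      bs∋ : ∀ {x} → x ∈ bs → lookup γ x ≡ j × x ≢ v
      bs∋ = proj₂ ∘ ∈-filter⁻ rest? {xs = allFin n}

    -- The permutation π of a matching exchanges class i with a part of class j that omits v; composing with π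
    -- the tuples that contain v turns structures coloured by γ injectively into structures coloured by γ′.
    weight-recolour : classSize γ i < classSize γ j → weight γ ≤ weight γ′
    weight-recolour i<j = ≤-trans
      (count-fibres (structureSetoid L n) (γ ◂?_) (γ′ ◂?_) (structures-unique n) structures-complete
        (compose π) (λ N → compose (flip π) N ∷ []) 1 (λ _ → ≤-refl)
        λ M N γ◂M M′≈N → ◂-resp γ′ M′≈N (coloured γ◂M , symmetric γ◂M) , here (restore M′≈N))
      (≤-reflexive (*-identityˡ _))
      where
      open Twist v

      i≢j : i ≢ j
      i≢j eq = <-irrefl (cong (classSize γ) eq) i<j

      -- Leaving `v` out of class `j` costs one element, which the strict inequality between the
      -- class sizes pays for.
      as≤bs : length as ≤ length bs
      as≤bs = s≤s⁻¹ (begin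
        suc (length as)             ≡⟨ cong suc (length-filter (class? γ i) (allFin n)) ⟩
        suc (classSize γ i)         ≤⟨ i<j ⟩
        classSize γ j               ≤⟨ count≤length (setoid (Fin n)) (class? γ j) (Unique.allFin⁺ n) (v ∷ bs) covered ⟩
        suc (length bs)             ∎)
        where
        open ≤-Reasoning
        covered : ∀ x → lookup γ x ≡ j → x ∈ v ∷ bs
        covered x γx≡j with x Fin.≟ v
        ... | yes x≡v = here x≡v
        ... | no x≢v  = there (∈bs γx≡j x≢v)

      match : ∃ λ π → Matches π as bs
      match = matching (Unique.filter⁺ (class? γ i) (Unique.allFin⁺ n)) (Unique.filter⁺ rest? (Unique.allFin⁺ n))
        (λ p q → i≢j (trans (sym (as∋ p)) (proj₁ (bs∋ q)))) as≤bs

      π = proj₁ match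
      open Matches (proj₂ match)

      πv≡v : π ⟨$⟩ʳ v ≡ v
      πv≡v = other (λ p → i≢j (sym (as∋ p))) (λ p → proj₂ (bs∋ p) refl)

      compose : Permutation′ n → Structure L n → Structure L n
      compose σ M = record { interp = λ k a → interp M k (twist σ a) }

      restore : ∀ {M N} → compose π M ≈ₛ N → M ≈ₛ compose (flip π) N
      restore {M} M′≈N k a = trans (sym (cong (interp M k) (untwist π πv≡v a))) (M′≈N k (twist (flip π) a))

      symmetric : ∀ {M} → γ ◂ M → SymmetricOn (compose π M)
      symmetric {M} (_ , sy) k k∈I τ a h = trans (cong (interp M k) (twist-permute π τ a)) (sy k k∈I τ _ h)

      class-i : ∀ {x} → lookup γ x ≡ i → lookup γ (π ⟨$⟩ʳ x) ≡ j
      class-i = proj₁ ∘ bs∋ ∘ left ∘ ∈as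

      class-j : ∀ {x} → lookup γ x ≡ j → x ≢ v → lookup γ (π ⟨$⟩ʳ x) ≡ i ⊎ lookup γ (π ⟨$⟩ʳ x) ≡ j
      class-j γx≡j x≢v with right (∈bs γx≡j x≢v)
      ... | inj₁ p = inj₁ (as∋ p)
      ... | inj₂ p = inj₂ (proj₁ (bs∋ p))

      class-other : ∀ {x} → lookup γ x ≢ i → lookup γ x ≢ j → π ⟨$⟩ʳ x ≡ x
      class-other ≢i ≢j = other (≢i ∘ as∋) (≢j ∘ proj₁ ∘ bs∋)

      module _ {r : ℕ} (a : Vec (Fin n) r) (p₀ : Fin r) (at-p₀ : lookup a p₀ ≡ v)
          (rb : Rainbow (lookup γ) (map (π ⟨$⟩ʳ_) a)) where

        rb′ : ∀ {p q} → p ≢ q → lookup γ (π ⟨$⟩ʳ lookup a p) ≢ lookup γ (π ⟨$⟩ʳ lookup a q)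
        rb′ {p} {q} p≢q eq = rb p q p≢q
            (trans (cong (lookup γ) (lookup-map p _ a)) (trans eq (cong (lookup γ) (sym (lookup-map q _ a)))))

        γπ-p₀ : lookup γ (π ⟨$⟩ʳ lookup a p₀) ≡ j
        γπ-p₀ = cong (lookup γ) (trans (cong (π ⟨$⟩ʳ_) at-p₀) πv≡v)

        not-j : ∀ {p} → lookup a p ≢ v → lookup γ (π ⟨$⟩ʳ lookup a p) ≢ j
        not-j ap≢v eq = rb′ {q = p₀} (λ where refl → ap≢v at-p₀) (trans eq (sym γπ-p₀))

        -- The entry `v` is fixed by `π` and has colour `j`, so no other entry is sent into class
        -- `j`. Hence no other entry lies in class `i`, which `π` maps into class `j`; those in
        -- class `j` are sent to class `i`, so there is at most one; the remaining ones are fixed by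
        -- `π`. Thus `i` is free for `v` in the new colouring.
        rainbow-twisted : Rainbow (lookup γ′) a
        rainbow-twisted p q p≢q eq with lookup a p Fin.≟ v | lookup a q Fin.≟ v
        ... | yes ap≡v | yes aq≡v = rb′ p≢q (cong (λ x → lookup γ (π ⟨$⟩ʳ x)) (trans ap≡v (sym aq≡v)))
        ... | yes ap≡v | no aq≢v  = not-j aq≢v
            (class-i (trans (sym (γ′-old aq≢v)) (trans (sym eq) (trans (cong (lookup γ′) ap≡v) γ′-new))))
        ... | no ap≢v  | yes aq≡v = not-j ap≢v
            (class-i (trans (sym (γ′-old ap≢v)) (trans eq (trans (cong (lookup γ′) aq≡v) γ′-new))))
        ... | no ap≢v  | no aq≢v  with same ← trans (sym (γ′-old ap≢v)) (trans eq (γ′-old aq≢v))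
                                        | lookup γ (lookup a p) Fin.≟ i
        ...   | yes ≡i = not-j ap≢v (class-i ≡i)
        ...   | no ≢i with lookup γ (lookup a p) Fin.≟ j
        ...     | no ≢j = rb′ p≢q (trans (cong (lookup γ) (class-other ≢i ≢j)) (trans same (sym (cong (lookup γ)
                            (class-other (≢i ∘ trans same) (≢j ∘ trans same))))))
        ...     | yes ≡j with class-j ≡j ap≢v | class-j (trans (sym same) ≡j) aq≢v
        ...       | inj₂ e  | _       = not-j ap≢v e
        ...       | inj₁ _  | inj₂ e  = not-j aq≢v e
        ...       | inj₁ e  | inj₁ e′ = rb′ p≢q (trans e (sym e′))

      coloured : ∀ {M} → γ ◂ M → StrongColouring l (compose π M) (lookup γ′)
      coloured {M} (col , _) k a h with occurs? a
      ... | yes (p₀ , at-p₀) = rainbow-twisted a p₀ at-p₀ (col k _ h)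
      ... | no ¬occ          = λ p q p≢q eq → col k a h p q p≢q
        (trans (sym (γ′-old (λ e → ¬occ (p , e)))) (trans eq (γ′-old (λ e → ¬occ (q , e)))))

  module _ {n : ℕ} (i : Fin l) (t : ℕ) where

    -- A vertex that is not counted lies in one of at most `l` classes no larger than class `i`,
    -- each of size below `t`.
    many-large : (γ : Colouring n) → classSize γ i < t →
                 n ≤ count (λ v → classSize γ i <? classSize γ (lookup γ v)) (allFin n) + l * t
    many-large γ s<t = begin
      n                                     ≡⟨ length-allFin n ⟨
      length (allFin n)                     ≡⟨ trans (∑-const (allFin n) 1) (*-identityʳ _) ⟨
      ∑ (allFin n) (λ _ → 1)                ≤⟨ ∑-mono (allFin n) (λ v → split (large? (lookup γ v))) ⟩
      ∑ (allFin n) (λ v → 𝟙 (large? (lookup γ v)) + 𝟙 (¬? (large? (lookup γ v))))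
                                            ≡⟨ ∑-+ (allFin n) _ _ ⟩
      count (λ v → large? (lookup γ v)) (allFin n) + ∑ (allFin n) (λ v → 𝟙 (¬? (large? (lookup γ v))))
                                            ≤⟨ +-monoʳ-≤ (count (λ v → large? (lookup γ v)) (allFin n)) small ⟩
      count (λ v → large? (lookup γ v)) (allFin n) + l * t ∎
      where
      open ≤-Reasoning
      large? : ∀ c → Dec (classSize γ i < classSize γ c)
      large? c = classSize γ i <? classSize γ c
      split : {X : Set} (d : Dec X) → 1 ≤ 𝟙 d + 𝟙 (¬? d)
      split (yes _) = ≤-refl
      split (no _)  = ≤-refl
      bounded : ∀ c (d : Dec (classSize γ i < classSize γ c)) → 𝟙 (¬? d) * classSize γ c ≤ t
      bounded c (yes _) = z≤n
      bounded c (no ≮)  = ≤-trans (≤-reflexive (*-identityˡ _)) (≤-trans (≮⇒≥ ≮) (<⇒≤ s<t))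
      small : ∑ (allFin n) (λ v → 𝟙 (¬? (large? (lookup γ v)))) ≤ l * t
      small = begin
        ∑ (allFin n) (λ v → 𝟙 (¬? (large? (lookup γ v))))
          ≤⟨ ∑-mono (allFin n) (λ v → ≤-trans
              (≤-reflexive (sym (trans (cong (𝟙 (¬? (large? (lookup γ v))) *_) (𝟙-yes refl (class? γ (lookup γ v) v)))
              (*-identityʳ _))))
               (∈⇒≤∑ (λ c → 𝟙 (¬? (large? c)) * 𝟙 (class? γ c v)) (∈-allFin (lookup γ v)))) ⟩
        ∑ (allFin n) (λ v → ∑ (allFin l) (λ c → 𝟙 (¬? (large? c)) * 𝟙 (class? γ c v)))
          ≡⟨ ∑-swap (allFin n) (allFin l) _ ⟩
        ∑ (allFin l) (λ c → ∑ (allFin n) (λ v → 𝟙 (¬? (large? c)) * 𝟙 (class? γ c v)))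
          ≡⟨ ∑-cong (allFin l) (λ c → ∑-*ˡ (allFin n) (𝟙 (¬? (large? c))) _) ⟩
        ∑ (allFin l) (λ c → 𝟙 (¬? (large? c)) * classSize γ c)
          ≤⟨ ∑-mono (allFin l) (λ c → bounded c (large? c)) ⟩
        ∑ (allFin l) (λ _ → t)
          ≡⟨ trans (∑-const (allFin l) t) (cong (_* t) (length-allFin l)) ⟩
        l * t ∎

    movable? : (γ : Colouring n) (v : Fin n) → Dec (classSize γ i < t × classSize γ i < classSize γ (lookup γ v))
    movable? γ v = (classSize γ i <? t) ×-dec (classSize γ i <? classSize γ (lookup γ v))

    moved? : (γ : Colouring n) (v : Fin n) → Dec (lookup γ v ≡ i × classSize γ i ≤ t)
    moved? γ v = class? γ i v ×-dec (classSize γ i ≤? t)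

    -- Given `v` and the result `δ`, the old colour of `v` determines `γ`, which leaves `l`
    -- possibilities. In `δ` the vertex `v` has colour `i`, and class `i` has grown by one, to at
    -- most `t`.
    recolour-fibre : ∀ v δ → ∑ (colourings n) (λ γ → 𝟙 (movable? γ v) * 𝟙 (recolour v i γ ≟ᶜ δ)) ≤ l * 𝟙 (moved? δ v)
    recolour-fibre v δ = ≤-trans (≤-reflexive (∑-cong (colourings n) λ γ → 𝟙-× (movable? γ v) (recolour v i γ ≟ᶜ δ)))
        (bound (moved? δ v))
      where
      𝟙-× : {X Y : Set} (d : Dec X) (e : Dec Y) → 𝟙 d * 𝟙 e ≡ 𝟙 (d ×-dec e)
      𝟙-× (no _)  _ = refl
      𝟙-× (yes _) e = *-identityˡ (𝟙 e)
      into : ∀ γ → (classSize γ i < t × classSize γ i < classSize γ (lookup γ v)) × recolour v i γ ≡ δ →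
          lookup δ v ≡ i × classSize δ i ≤ t
      into γ ((s<t , _) , refl) = Vec.lookup∘update v γ i , ≤-trans
        (count≤length (setoid (Fin n)) (class? (recolour v i γ) i) (Unique.allFin⁺ n)
            (v ∷ filter (class? γ i) (allFin n)) covered)
        (≤-trans (≤-reflexive (cong suc (length-filter (class? γ i) (allFin n)))) s<t)
        where
        covered : ∀ x → lookup (recolour v i γ) x ≡ i → x ∈ v ∷ filter (class? γ i) (allFin n)
        covered x eq with x Fin.≟ v
        ... | yes x≡v = here x≡v
        ... | no x≢v  = there (∈-filter⁺ (class? γ i) (∈-allFin x) (trans (sym (Vec.lookup∘update′ x≢v γ i)) eq))
      both? : ∀ γ → Dec ((classSize γ i < t × classSize γ i < classSize γ (lookup γ v)) × recolour v i γ ≡ δ)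
      both? γ = movable? γ v ×-dec (recolour v i γ ≟ᶜ δ)
      bound : (d : Dec (lookup δ v ≡ i × classSize δ i ≤ t)) → count both? (colourings n) ≤ l * 𝟙 d
      bound (no ¬m) = ≤-trans (count≤length (setoid (Colouring n)) both? (tuples-unique l n) []
          λ γ b → contradiction (into γ b) ¬m) z≤n
      bound (yes _) = ≤-trans
        (count≤length (setoid (Colouring n)) both? (tuples-unique l n)
            (List.map (λ c → recolour v c δ) (allFin l)) λ γ b → subst (_∈ _) (undo γ (proj₂ b))
           (∈-map⁺ (λ c → recolour v c δ) (∈-allFin (lookup γ v))))
        (≤-reflexive (trans (List.length-map _ (allFin l)) (trans (length-allFin l) (sym (*-identityʳ l)))))
        where
        undo : ∀ γ → recolour v i γ ≡ δ → recolour v (lookup γ v) δ ≡ γ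
        undo γ refl = trans (Vec.[]≔-idempotent γ v) (Vec.[]≔-lookup γ v)

    -- Double counting of moves: `spread` bounds from below those that leave a colouring with a
    -- small class, `gather` from above those that reach a given `δ`.
    small-class-rare : (n ∸ l * t) * ∑ (colourings n) (λ γ → 𝟙 (classSize γ i <? t) * weight γ) ≤
                       l * t * ∑ (colourings n) weight
    small-class-rare = begin
      (n ∸ l * t) * ∑ (colourings n) (λ γ → 𝟙 (classSize γ i <? t) * weight γ)
        ≡⟨ ∑-*ˡ (colourings n) (n ∸ l * t) _ ⟨
      ∑ (colourings n) (λ γ → (n ∸ l * t) * (𝟙 (classSize γ i <? t) * weight γ))
        ≤⟨ ∑-mono (colourings n) spread ⟩
      ∑ (colourings n) (λ γ → ∑ (allFin n) (λ v → 𝟙 (movable? γ v) * weight (recolour v i γ)))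
        ≡⟨ ∑-swap (colourings n) (allFin n) _ ⟩
      ∑ (allFin n) (λ v → ∑ (colourings n) (λ γ → 𝟙 (movable? γ v) * weight (recolour v i γ)))
        ≤⟨ ∑-mono (allFin n) (λ v → ∑-fibres _≟ᶜ_ (colourings n) tuples-complete
             (λ γ → 𝟙 (movable? γ v)) (recolour v i) (λ δ → l * 𝟙 (moved? δ v)) weight (recolour-fibre v)) ⟩
      ∑ (allFin n) (λ v → ∑ (colourings n) (λ δ → l * 𝟙 (moved? δ v) * weight δ))
        ≡⟨ ∑-swap (allFin n) (colourings n) _ ⟩
      ∑ (colourings n) (λ δ → ∑ (allFin n) (λ v → l * 𝟙 (moved? δ v) * weight δ))
        ≤⟨ ∑-mono (colourings n) gather ⟩
      ∑ (colourings n) (λ δ → l * t * weight δ)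
        ≡⟨ ∑-*ˡ (colourings n) (l * t) weight ⟩
      l * t * ∑ (colourings n) weight ∎
      where
      open ≤-Reasoning
      spread : ∀ γ → (n ∸ l * t) * (𝟙 (classSize γ i <? t) * weight γ) ≤ ∑ (allFin n)
          (λ v → 𝟙 (movable? γ v) * weight (recolour v i γ))
      spread γ = go (classSize γ i <? t)
       where
       go : (d : Dec (classSize γ i < t)) → (n ∸ l * t) * (𝟙 d * weight γ) ≤
            ∑ (allFin n) (λ v → 𝟙 (d ×-dec (classSize γ i <? classSize γ (lookup γ v))) * weight (recolour v i γ))
       go (no _)    = ≤-trans (≤-reflexive (*-zeroʳ (n ∸ l * t))) z≤n
       go (yes s<t) = begin
        (n ∸ l * t) * (1 * weight γ)
          ≤⟨ *-mono-≤ (m≤n+o⇒m∸n≤o n (l * t) (≤-trans (many-large γ s<t) (≤-reflexive (+-comm _ (l * t)))))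
              (≤-reflexive (*-identityˡ (weight γ))) ⟩
        count (λ v → classSize γ i <? classSize γ (lookup γ v)) (allFin n) * weight γ
          ≡⟨ ∑-*ʳ (allFin n) (weight γ) _ ⟨
        ∑ (allFin n) (λ v → 𝟙 (classSize γ i <? classSize γ (lookup γ v)) * weight γ)
          ≤⟨ ∑-mono (allFin n) (λ v → heavier v (classSize γ i <? classSize γ (lookup γ v))) ⟩
        ∑ (allFin n) (λ v → 𝟙 (yes s<t ×-dec (classSize γ i <? classSize γ (lookup γ v))) * weight (recolour v i γ)) ∎
        where
        heavier : ∀ v (d : Dec (classSize γ i < classSize γ (lookup γ v))) →
                  𝟙 d * weight γ ≤ 𝟙 (yes s<t ×-dec d) * weight (recolour v i γ)
        heavier v (no _)  = z≤n
        heavier v (yes p) = *-monoʳ-≤ 1 (weight-recolour γ v i p)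
      gather : ∀ δ → ∑ (allFin n) (λ v → l * 𝟙 (moved? δ v) * weight δ) ≤ l * t * weight δ
      gather δ = ≤-trans (≤-reflexive (trans (∑-*ʳ (allFin n) (weight δ) _) (cong (_* weight δ) (∑-*ˡ (allFin n) l _))))
        (*-monoˡ-≤ (weight δ) (*-monoʳ-≤ l (at-most-t (classSize δ i ≤? t))))
        where
        at-most-t : (d : Dec (classSize δ i ≤ t)) → count (λ v → class? δ i v ×-dec d) (allFin n) ≤ t
        at-most-t (yes s≤t) = ≤-trans (count-mono (λ v → class? δ i v ×-dec yes s≤t) (class? δ i) (allFin n)
            λ _ → proj₁) s≤t
        at-most-t d@(no s≰t) = ≤-trans (count≤length (setoid (Fin n)) (λ v → class? δ i v ×-dec d)
            (Unique.allFin⁺ n) [] λ _ p → contradiction (proj₂ p) s≰t) z≤n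

-- Asymptotic negligibility

infix 4 _≪_
-- Little-o with the division cleared: the quotient of `f` by `g` is eventually below every `1 / K`.
_≪_ : (f g : ℕ → ℕ) → Set
f ≪ g = ∀ K → ∃ λ N → ∀ n → N ≤ n → K * f n ≤ g n

≪-+ : ∀ {f g h} → f ≪ h → g ≪ h → (λ n → f n + g n) ≪ h
≪-+ {f} {g} {h} f≪h g≪h K with N₁ , p₁ ← f≪h (2 * K) | N₂ , p₂ ← g≪h (2 * K) =
  N₁ ⊔ N₂ , λ n N≤n → *-cancelˡ-≤ 2 (begin
    2 * (K * (f n + g n))       ≡⟨ expand K (f n) (g n) ⟩
    2 * K * f n + 2 * K * g n   ≤⟨ +-mono-≤ (p₁ n (m⊔n≤o⇒m≤o N₁ N₂ N≤n)) (p₂ n (m⊔n≤o⇒n≤o N₁ N₂ N≤n)) ⟩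
    h n + h n                   ≡⟨ cong (h n +_) (+-identityʳ (h n)) ⟨
    2 * h n                     ∎)
  where
  open ≤-Reasoning
  expand : ∀ K a b → 2 * (K * (a + b)) ≡ 2 * K * a + 2 * K * b
  expand = solve-∀

≪-∑ : {X : Set} (xs : List X) (f : X → ℕ → ℕ) {h : ℕ → ℕ} → (∀ x → f x ≪ h) → (λ n → ∑ xs (λ x → f x n)) ≪ h
≪-∑ []       f f≪h = λ K → 0 , λ n _ → ≤-trans (≤-reflexive (*-zeroʳ K)) z≤n
≪-∑ (x ∷ xs) f f≪h = ≪-+ (f≪h x) (≪-∑ xs f f≪h)

≪-mono : ∀ {f g h} → (∀ n → f n ≤ g n) → g ≪ h → f ≪ h
≪-mono f≤g g≪h K with N , p ← g≪h K = N , λ n N≤n → ≤-trans (*-monoʳ-≤ K (f≤g n)) (p n N≤n)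

-- Used with `g` of order √n against a constant `C` for balanced colourings, and with `g` of order
-- `n` against `C` of order √n for the others.
≪-cancel : ∀ {f h} (g C : ℕ → ℕ) → (∀ n → NonZero (C n)) → (∀ K → ∃ λ N → ∀ n → N ≤ n → K * C n ≤ g n) →
           (∀ n → g n * f n ≤ C n * h n) → f ≪ h
≪-cancel {f} {h} g C nz large p K with N , K≤g ← large K = N , λ n N≤n → *-cancelˡ-≤ (C n) {{nz n}} (begin
  C n * (K * f n)   ≡⟨ *-assoc (C n) K (f n) ⟨
  C n * K * f n     ≡⟨ cong (_* f n) (*-comm (C n) K) ⟩
  K * C n * f n     ≤⟨ *-monoˡ-≤ (f n) (K≤g n N≤n) ⟩
  g n * f n         ≤⟨ p n ⟩
  C n * h n         ∎)
  where open ≤-Reasoning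

isqrt : ℕ → ℕ
isqrt zero = 0
isqrt (suc n) with suc (isqrt n) * suc (isqrt n) ≤? suc n
... | yes _ = suc (isqrt n)
... | no _  = isqrt n

isqrt-lower : ∀ n → isqrt n * isqrt n ≤ n
isqrt-lower zero = z≤n
isqrt-lower (suc n) with suc (isqrt n) * suc (isqrt n) ≤? suc n
... | yes p = p
... | no _  = m≤n⇒m≤1+n (isqrt-lower n)

isqrt-upper : ∀ n → n < suc (isqrt n) * suc (isqrt n)
isqrt-upper zero = s≤s z≤n
isqrt-upper (suc n) with suc (isqrt n) * suc (isqrt n) ≤? suc n
... | yes _ = ≤-trans (s≤s (isqrt-upper n)) (*-mono-< (n<1+n (suc (isqrt n))) (n<1+n (suc (isqrt n))))
... | no ¬p = ≰⇒> ¬p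

isqrt-large : ∀ K n → K * K ≤ n → K ≤ isqrt n
isqrt-large K n K²≤n with K ≤? isqrt n
... | yes p = p
... | no ¬p = contradiction (≤-trans (isqrt-upper n) (≤-trans (*-mono-≤ (≰⇒> ¬p) (≰⇒> ¬p)) K²≤n)) (<-irrefl refl)

-- Two terms of the binomial expansion; with `k = d` they show that `(suc d / d) ^ suc d` is at
-- least 2 for nonzero `d`.
bernoulli : ∀ d k → d ^ suc k + suc k * d ^ k ≤ suc d ^ suc k
bernoulli d zero    = ≤-reflexive (start d)
  where
  start : ∀ d → d * 1 + 1 * 1 ≡ suc d * 1
  start = solve-∀
bernoulli d (suc k) = begin
  d * (d * d ^ k) + suc (suc k) * (d * d ^ k)                             ≤⟨ m≤m+n _ (suc k * d ^ k) ⟩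
  d * (d * d ^ k) + suc (suc k) * (d * d ^ k) + suc k * d ^ k             ≡⟨ expand d k (d ^ k) ⟩
  suc d * (d * d ^ k + suc k * d ^ k)                                     ≤⟨ *-monoʳ-≤ (suc d) (bernoulli d k) ⟩
  suc d * suc d ^ suc k                                                   ∎
  where
  open ≤-Reasoning
  expand : ∀ d k x → d * (d * x) + suc (suc k) * (d * x) + suc k * x ≡ suc d * (d * x + suc k * x)
  expand = solve-∀

^-distribʳ-* : ∀ k a b → (a * b) ^ k ≡ a ^ k * b ^ k
^-distribʳ-* zero    a b = refl
^-distribʳ-* (suc k) a b = trans (cong (a * b *_) (^-distribʳ-* k a b)) (interchange a b (a ^ k) (b ^ k))
  where
  interchange : ∀ a b x y → a * b * (x * y) ≡ a * x * (b * y)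
  interchange = solve-∀

n<2^n : ∀ n → n < 2 ^ n
n<2^n zero    = s≤s z≤n
n<2^n (suc n) = begin
  suc (suc n)     ≡⟨ +-comm 1 (suc n) ⟩
  suc n + 1       ≤⟨ +-mono-≤ (n<2^n n) (m^n>0 2 n) ⟩
  2 ^ n + 2 ^ n   ≡⟨ cong (2 ^ n +_) (+-identityʳ (2 ^ n)) ⟨
  2 * 2 ^ n       ∎
  where open ≤-Reasoning

-- Every `suc d` factors `suc d / d` are worth a factor 2, so the exponent yields `2 ^ (p * w)`, and
-- `2 ^ w` is at least `suc w`.
exponential-beats-power : ∀ d p w → suc w ^ p * d ^ (suc d * (p * w)) ≤ suc d ^ (suc d * (p * w))
exponential-beats-power d p w = begin
  suc w ^ p * d ^ (suc d * (p * w))               ≤⟨ *-monoˡ-≤ _ (^-monoˡ-≤ p (n<2^n w)) ⟩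
  (2 ^ w) ^ p * d ^ (suc d * (p * w))             ≡⟨ cong (_* d ^ (suc d * (p * w)))
      (trans (^-*-assoc 2 w p) (cong (2 ^_) (*-comm w p))) ⟩
  2 ^ (p * w) * d ^ (suc d * (p * w))             ≡⟨ cong (2 ^ (p * w) *_) (^-*-assoc d (suc d) (p * w)) ⟨
  2 ^ (p * w) * (d ^ suc d) ^ (p * w)             ≡⟨ ^-distribʳ-* (p * w) 2 (d ^ suc d) ⟨
  (2 * d ^ suc d) ^ (p * w)                       ≤⟨ ^-monoˡ-≤ (p * w) double ⟩
  (suc d ^ suc d) ^ (p * w)                       ≡⟨ ^-*-assoc (suc d) (suc d) (p * w) ⟩
  suc d ^ (suc d * (p * w))                       ∎
  where
  open ≤-Reasoning
  double : 2 * d ^ suc d ≤ suc d ^ suc d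
  double = begin
    2 * d ^ suc d                   ≡⟨ cong (d ^ suc d +_) (+-identityʳ (d ^ suc d)) ⟩
    d ^ suc d + d * d ^ d           ≤⟨ +-monoʳ-≤ (d ^ suc d) (m≤n+m (d * d ^ d) (d ^ d)) ⟩
    d ^ suc d + suc d * d ^ d       ≤⟨ bernoulli d d ⟩
    suc d ^ suc d                   ∎

-- Failures of extension properties among coloured pairs

module Asymptotics (l : ℕ) (L : Vocabulary) (I : Subset (ρ L)) where

  open Balance l L I public

  total : ℕ → ℕ
  total n = ∑ (colourings n) weight

  fails? : ∀ {n} m (γ : Colouring n) (M : Structure L n) → Dec (γ ◂ M × ¬ Ext m M γ)
  fails? m γ M = (γ ◂? M) ×-dec ¬? (ext? m M γ)

  fails : ℕ → ℕ → ℕ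
  fails m n = ∑ (colourings n) (λ γ → count (fails? m γ) (structures n))

  module _ (m : ℕ) where
    private
      d p : ℕ
      d = length (structures (suc m))
      -- `m + m` factors `suc (isqrt n)` pay for the `n ^ m` tuples of the union bound; the extra
      -- one makes the failing share tend to zero.
      p = suc (m + m)

      -- The class sizes considered are of order √n: small enough to be rare, large enough for the union bound.
      s : ℕ → ℕ
      s n = suc d * (p * isqrt n)

      -- The summand `m` makes up for the entries of `e`, which are not candidates.
      t : ℕ → ℕ
      t n = s n + m

      instance
        d-nonZero : NonZero d
        d-nonZero = >-nonZero (Membershipₚ.∈-length (structureSetoid L (suc m))
          (structures-complete (record { interp = λ _ _ → false })))

    Case : ℕ → Set
    Case n = Vec (Fin n) m × Fin l × Structure L (suc m)

    cases : ∀ n → List (Case n)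
    cases n = cartesianProductWith _,_ (tuples n m) (cartesianProductWith _,_ (allFin l) (structures (suc m)))

    length-cases : ∀ n → length (cases n) ≡ n ^ m * (l * d)
    length-cases n = trans (length-cartesianProductWith _,_ (tuples n m)
        (cartesianProductWith _,_ (allFin l) (structures (suc m)))) (cong₂ _*_ (length-tuples n m)
      (trans (length-cartesianProductWith _,_ (allFin l) (structures (suc m))) (cong (_* d) (length-allFin l))))

    module _ {n : ℕ} (γ : Colouring n) where

      Unextended : Case n → Structure L n → Set
      Unextended (e , c , Q) M = γ ◂ M × ¬ Extends M γ e c Q

      unextended? : ∀ x M → Dec (Unextended x M)
      unextended? (e , c , Q) M = (γ ◂? M) ×-dec ¬? (extends? M γ e c Q)

      candidates-bound : ∀ c (e : Vec (Fin n) m) → classSize γ c ≤ length (candidates γ c e) + m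
      candidates-bound c e = begin
        classSize γ c                                                   ≤⟨ count≤length (setoid (Fin n)) (class? γ c)
            (Unique.allFin⁺ n) _ covered ⟩
        length (candidates γ c e List.++ List.tabulate (lookup e))      ≡⟨ List.length-++ (candidates γ c e) ⟩
        length (candidates γ c e) + length (List.tabulate (lookup e))   ≡⟨ cong (length (candidates γ c e) +_)
            (List.length-tabulate (lookup e)) ⟩
        length (candidates γ c e) + m                                   ∎
        where
        open ≤-Reasoning
        covered : ∀ v → lookup γ v ≡ c → v ∈ candidates γ c e List.++ List.tabulate (lookup e)
        covered v γv≡c with Fin.any? (λ i → lookup e i Fin.≟ v)
        ... | yes (i , refl) = List∈.∈-++⁺ʳ (candidates γ c e) (List∈.∈-tabulate⁺ {f = lookup e} i)
        ... | no ¬i = List∈.∈-++⁺ˡ (∈-filter⁺ (candidate? γ c e) (∈-allFin v) (γv≡c , λ i ei≡v → ¬i (i , ei≡v)))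

      unextended-bound : (∀ c → t n ≤ classSize γ c) → ∀ x →
                         suc d ^ s n * count (unextended? x) (structures n) ≤ d ^ s n * weight γ
      unextended-bound big (e , c , Q) with isPattern? γ e c Q
      ... | no ¬pat = ≤-trans (*-monoʳ-≤ (suc d ^ s n)
          (count≤length (structureSetoid L n) (unextended? (e , c , Q)) (structures-unique n) []
                        λ M (_ , ¬ext) → contradiction (λ pat → contradiction pat ¬pat) ¬ext))
                        (≤-trans (≤-reflexive (*-zeroʳ (suc d ^ s n))) z≤n)
      ... | yes pat = ≤-trans (*-monoʳ-≤ (suc d ^ s n)
                          (count-mono (unextended? (e , c , Q)) (missed? γ e c Q (candidates γ c e))
                              (structures n) unextended⇒missed))
                        (missed-bound γ e c Q pat (s n) (Unique.filter⁺ (candidate? γ c e) (Unique.allFin⁺ n))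
                          (All.all-filter (candidate? γ c e) (allFin n))
                          (+-cancelʳ-≤ m _ _ (≤-trans (big c) (candidates-bound c e))))
        where
        unextended⇒missed : ∀ M → Unextended (e , c , Q) M → Missed γ e c Q (candidates γ c e) M
        unextended⇒missed M (col , ¬ext) =
          col , decidable-stable (agrees? M e Q) (λ ¬agr → ¬ext λ _ agr → contradiction agr ¬agr) , λ any → ¬ext λ _ _ →
              any

      -- The union bound, pointwise in `M`: if no case contributes, decidability of `Extends` gives
      -- `Ext` itself.
      fails≤unextended : ∀ M → 𝟙 (fails? m γ M) ≤ ∑ (cases n) (λ x → 𝟙 (unextended? x M))
      fails≤unextended M with ∑ (cases n) (λ x → 𝟙 (unextended? x M)) in eq
      ... | suc k = ≤-trans (𝟙≤1 (fails? m γ M)) (s≤s z≤n)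
        where
        𝟙≤1 : {X : Set} (x : Dec X) → 𝟙 x ≤ 1
        𝟙≤1 (yes _) = ≤-refl
        𝟙≤1 (no _)  = z≤n
      ... | zero  = ≤-reflexive (𝟙-no none (fails? m γ M))
        where
        none : ¬ (γ ◂ M × ¬ Ext m M γ)
        none (col , ¬ext) = ¬ext λ e c → All.tabulate λ {Q} Q∈ → decidable-stable (extends? M γ e c Q) λ ¬extends →
          1+n≰n (≤-trans (≤-reflexive (sym (𝟙-yes (col , ¬extends) (unextended? (e , c , Q) M))))
            (≤-trans (∈⇒≤∑ (λ x → 𝟙 (unextended? x M))
                (∈-cartesianProductWith⁺ _,_ (tuples-complete e) (∈-cartesianProductWith⁺ _,_ (∈-allFin c) Q∈)))
                     (≤-reflexive eq)))

      -- With `w = suc (isqrt n)` there are at most `w ^ (m + m) * (l * d)` cases, each with a share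
      -- of at most `(d / suc d) ^ s n`, hence of at most `1 / w ^ p`. One factor `w` is left over.
      fails-bound : (∀ c → t n ≤ classSize γ c) → suc (isqrt n) * count (fails? m γ) (structures n) ≤ l * d * weight γ
      fails-bound big = *-cancelˡ-≤ (w ^ (m + m) * d ^ s n)
          {{m*n≢0 (w ^ (m + m)) (d ^ s n) {{m^n≢0 w (m + m)}} {{m^n≢0 d (s n)}}}} (begin
        w ^ (m + m) * d ^ s n * (w * x)              ≡⟨ shuffle (w ^ (m + m)) (d ^ s n) w x ⟩
        w ^ p * d ^ s n * x                          ≤⟨ *-monoˡ-≤ x (exponential-beats-power d p (isqrt n)) ⟩
        suc d ^ s n * x                              ≤⟨ *-monoʳ-≤ (suc d ^ s n)
            (∑-mono (structures n) fails≤unextended) ⟩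
        suc d ^ s n * ∑ (structures n) (λ M → ∑ (cases n) (λ y → 𝟙 (unextended? y M)))
                                                     ≡⟨ cong (suc d ^ s n *_) (∑-swap (structures n) (cases n)
                                                         (λ M y → 𝟙 (unextended? y M))) ⟩
        suc d ^ s n * ∑ (cases n) (λ y → count (unextended? y) (structures n))
                                                     ≡⟨ ∑-*ˡ (cases n) (suc d ^ s n)
                                                         (λ y → count (unextended? y) (structures n)) ⟨
        ∑ (cases n) (λ y → suc d ^ s n * count (unextended? y) (structures n))
                                                     ≤⟨ ∑-mono (cases n) (unextended-bound big) ⟩
        ∑ (cases n) (λ _ → d ^ s n * weight γ)       ≡⟨ trans (∑-const (cases n) _)
            (cong (_* (d ^ s n * weight γ)) (length-cases n)) ⟩
        n ^ m * (l * d) * (d ^ s n * weight γ)       ≤⟨ *-monoˡ-≤ _ (*-monoˡ-≤ (l * d) n^m≤) ⟩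
        w ^ (m + m) * (l * d) * (d ^ s n * weight γ) ≡⟨ shuffle′ (w ^ (m + m)) (l * d) (d ^ s n) (weight γ) ⟩
        w ^ (m + m) * d ^ s n * (l * d * weight γ)   ∎)
        where
        open ≤-Reasoning
        w = suc (isqrt n)
        x = count (fails? m γ) (structures n)
        shuffle : ∀ a b c x → a * b * (c * x) ≡ c * a * b * x
        shuffle = solve-∀
        shuffle′ : ∀ a b c x → a * b * (c * x) ≡ a * c * (b * x)
        shuffle′ = solve-∀
        n^m≤ : n ^ m ≤ w ^ (m + m)
        n^m≤ = ≤-trans (^-monoˡ-≤ m (<⇒≤ (isqrt-upper n)))
          (≤-reflexive (trans (^-distribʳ-* m w w) (sym (^-distribˡ-+-* w m m))))

    private
      balanced? : ∀ {n} (γ : Colouring n) → Dec (∀ c → t n ≤ classSize γ c)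
      balanced? {n} γ = Fin.all? λ c → t n ≤? classSize γ c

      balanced : ℕ → ℕ
      balanced n = ∑ (colourings n) (λ γ → 𝟙 (balanced? γ) * count (fails? m γ) (structures n))

      unbalanced : Fin l → ℕ → ℕ
      unbalanced c n = ∑ (colourings n) (λ γ → 𝟙 (classSize γ c <? t n) * weight γ)

      balanced≪total : balanced ≪ total
      -- The successor makes the constant nonzero for every `l`.
      balanced≪total = ≪-cancel (suc ∘ isqrt) (λ _ → suc (l * d)) (λ _ → _)
        (λ K → let J = K * suc (l * d) in J * J , λ n J²≤n → m≤n⇒m≤1+n (isqrt-large J n J²≤n))
        λ n → begin
          suc (isqrt n) * balanced n     ≡⟨ ∑-*ˡ (colourings n) (suc (isqrt n)) _ ⟨
          ∑ (colourings n) (λ γ → suc (isqrt n) * (𝟙 (balanced? γ) * count (fails? m γ) (structures n)))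
                                         ≤⟨ ∑-mono (colourings n) (λ γ → go γ (balanced? γ)) ⟩
          ∑ (colourings n) (λ γ → suc (l * d) * weight γ)
                                         ≡⟨ ∑-*ˡ (colourings n) (suc (l * d)) weight ⟩
          suc (l * d) * total n          ∎
        where
        open ≤-Reasoning
        go : ∀ {n} (γ : Colouring n) (b : Dec (∀ c → t n ≤ classSize γ c)) →
             suc (isqrt n) * (𝟙 b * count (fails? m γ) (structures n)) ≤ suc (l * d) * weight γ
        go {n} γ (no _)    = ≤-trans (≤-reflexive (*-zeroʳ (suc (isqrt n)))) z≤n
        go {n} γ (yes big) = ≤-trans (*-monoʳ-≤ (suc (isqrt n)) (≤-reflexive (*-identityˡ _)))
          (≤-trans (fails-bound γ big) (*-monoˡ-≤ (weight γ) (n≤1+n (l * d))))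

      C₀ : ℕ
      C₀ = suc (l * (suc d * p + m))

      lt≤ : ∀ n → l * t n ≤ C₀ * suc (isqrt n)
      lt≤ n = ≤-trans (m≤m+n (l * t n) _) (≤-reflexive (expand l d p m (isqrt n)))
        where
        expand : ∀ l d p m w → l * (suc d * (p * w) + m) + (l * (suc d * p) + l * m * w + suc w) ≡ suc
            (l * (suc d * p + m)) * suc w
        expand = solve-∀

      unbalanced≪total : ∀ c → unbalanced c ≪ total
      unbalanced≪total c = ≪-cancel (λ n → n ∸ l * t n) (λ n → C₀ * suc (isqrt n)) (λ _ → _) large
        λ n → ≤-trans (small-class-rare c (t n)) (*-monoˡ-≤ (total n) (lt≤ n))
        where
        large : ∀ K → ∃ λ N → ∀ n → N ≤ n → K * (C₀ * suc (isqrt n)) ≤ n ∸ l * t n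
        large K = J * J , λ n J²≤n → m+n≤o⇒m≤o∸n _ (bound n (isqrt-large J n J²≤n))
          where
          open ≤-Reasoning
          -- Both terms to be bounded sum to at most `suc K * C₀ * suc w`. The factor 2 turns
          -- `suc w` into `w`, and the last factor `w` is matched by `J`, giving `w * w`.
          J = 2 * (suc K * C₀)
          bound : ∀ n → J ≤ isqrt n → K * (C₀ * suc (isqrt n)) + l * t n ≤ n
          bound n J≤w = begin
            K * (C₀ * suc w) + l * t n            ≤⟨ +-monoʳ-≤ (K * (C₀ * suc w)) (lt≤ n) ⟩
            K * (C₀ * suc w) + C₀ * suc w         ≡⟨ regroup K C₀ w ⟩
            suc K * C₀ * (1 + w)                  ≤⟨ *-monoʳ-≤ (suc K * C₀) (+-monoˡ-≤ w (≤-trans (s≤s z≤n) J≤w)) ⟩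
            suc K * C₀ * (w + w)                  ≡⟨ regroup′ (suc K * C₀) w ⟩
            2 * (suc K * C₀) * w                  ≤⟨ *-monoˡ-≤ w J≤w ⟩
            w * w                                 ≤⟨ isqrt-lower n ⟩
            n                                     ∎
            where
            w = isqrt n
            regroup : ∀ K C w → K * (C * suc w) + C * suc w ≡ suc K * C * (1 + w)
            regroup = solve-∀
            regroup′ : ∀ x w → x * (w + w) ≡ 2 * x * w
            regroup′ = solve-∀

    abstract
      -- A colouring with large classes is charged its failures; any other one is charged its whole
      -- weight, under some colour whose class is small.
      fails≪total : fails m ≪ total
      fails≪total = ≪-mono split (≪-+ balanced≪total (≪-∑ (allFin l) unbalanced unbalanced≪total))
        where
        split : ∀ n → fails m n ≤ balanced n + ∑ (allFin l) (λ c → unbalanced c n)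
        split n = begin
          fails m n
            ≤⟨ ∑-mono (colourings n) (λ γ → go γ (balanced? γ)) ⟩
          ∑ (colourings n) (λ γ → 𝟙 (balanced? γ) * count (fails? m γ) (structures n) +
                                 ∑ (allFin l) (λ c → 𝟙 (classSize γ c <? t n) * weight γ))
            ≡⟨ ∑-+ (colourings n) _ _ ⟩
          balanced n + ∑ (colourings n) (λ γ → ∑ (allFin l) (λ c → 𝟙 (classSize γ c <? t n) * weight γ))
            ≡⟨ cong (balanced n +_) (∑-swap (colourings n) (allFin l) _) ⟩
          balanced n + ∑ (allFin l) (λ c → unbalanced c n) ∎
          where
          open ≤-Reasoning
          go : (γ : Colouring n) (b : Dec (∀ c → t n ≤ classSize γ c)) →
               count (fails? m γ) (structures n) ≤
               𝟙 b * count (fails? m γ) (structures n) + ∑ (allFin l) (λ c → 𝟙 (classSize γ c <? t n) * weight γ)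
          go γ (yes _)     = ≤-trans (≤-reflexive (sym (*-identityˡ _))) (m≤m+n _ _)
          go γ (no ¬big) with c , ¬t≤ ← Fin.¬∀⟶∃¬ l (λ c → t n ≤ classSize γ c) (λ c → t n ≤? classSize γ c) ¬big =
              begin
            count (fails? m γ) (structures n)         ≤⟨ count-mono (fails? m γ) (γ ◂?_) (structures n) (λ _ → proj₁) ⟩
            weight γ                                  ≡⟨ trans
                (cong (_* weight γ) (𝟙-yes (≰⇒> ¬t≤) (classSize γ c <? t n))) (*-identityˡ _) ⟨
            𝟙 (classSize γ c <? t n) * weight γ       ≤⟨ ∈⇒≤∑ (λ c → 𝟙 (classSize γ c <? t n) * weight γ) (∈-allFin c) ⟩
            ∑ (allFin l) (λ c → 𝟙 (classSize γ c <? t n) * weight γ) ∎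

-- Cliques and the uniqueness of colourings

Within : ∀ {n m r} → Vec (Fin n) r → Vec (Fin n) m → Set
Within t e = ∀ i → ∃ λ j → lookup e j ≡ lookup t i

update : ∀ {l} {X : Set} → (Fin l → X) → Fin l → X → Fin l → X
update c i x j = if does (j Fin.≟ i) then x else c j

update-at : ∀ {l} {X : Set} (c : Fin l → X) i x → update c i x i ≡ x
update-at c i x with i Fin.≟ i
... | yes _  = refl
... | no i≢i = contradiction refl i≢i

update-other : ∀ {l} {X : Set} (c : Fin l → X) i x {j} → j ≢ i → update c i x j ≡ c j
update-other c i x {j} j≢i with j Fin.≟ i
... | yes j≡i = contradiction j≡i j≢i
... | no _    = refl

injective⇒surjective : ∀ {l} (f : Fin l → Fin l) → (∀ i j → i ≢ j → f i ≢ f j) → ∀ y → ∃ λ i → f i ≡ y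
injective⇒surjective {suc l} f inj y with Fin.any? (λ i → f i Fin.≟ y)
... | yes p = p
... | no ¬p = contradiction (Fin.injective⇒≤ {f = λ i → Fin.punchOut (avoid i)}
        (λ {i} {j} eq → decidable-stable (i Fin.≟ j) λ i≢j → inj i j i≢j
            (Fin.punchOut-injective (avoid i) (avoid j) eq))) 1+n≰n
  where
  avoid : ∀ i → y ≢ f i
  avoid i eq = ¬p (i , sym eq)

-- The inclusion of `Fin r` in `Fin l` corrected by two transpositions: the first brings the image
-- of `p` to `i`, the second brings that of `q` to `j` and does not touch `i`.
injection-through : ∀ {l r} → r ≤ l → {p q : Fin r} → p ≢ q → {i j : Fin l} → i ≢ j →
                    ∃ λ (s : Vec (Fin l) r) → Rainbow id s × lookup s p ≡ i × lookup s q ≡ j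
injection-through {l} {r} r≤l {p} {q} p≢q {i} {j} i≢j =
  tabulate f , rainbow , trans (lookup∘tabulate f p) f-p , trans (lookup∘tabulate f q) (swap-left y j)
  where
  σ = Perm.transpose (Fin.inject≤ p r≤l) i
  y = σ ⟨$⟩ʳ Fin.inject≤ q r≤l
  f : Fin r → Fin l
  f x = Perm.transpose y j ⟨$⟩ʳ (σ ⟨$⟩ʳ Fin.inject≤ x r≤l)
  permutation-injective : ∀ (π : Permutation′ l) {x x′} → π ⟨$⟩ʳ x ≡ π ⟨$⟩ʳ x′ → x ≡ x′
  permutation-injective π eq = trans (sym (Perm.inverseˡ π)) (trans (cong (π ⟨$⟩ˡ_) eq) (Perm.inverseˡ π))
  f-injective : ∀ {x x′} → f x ≡ f x′ → x ≡ x′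
  f-injective eq = Fin.inject≤-injective r≤l r≤l _ _
      (permutation-injective σ (permutation-injective (Perm.transpose y j) eq))
  rainbow : Rainbow id (tabulate f)
  rainbow x x′ x≢x′ eq = x≢x′ (f-injective (trans (sym (lookup∘tabulate f x)) (trans eq (lookup∘tabulate f x′))))
  i≢y : i ≢ y
  i≢y i≡y = p≢q (Fin.inject≤-injective r≤l r≤l _ _
      (permutation-injective σ (trans (swap-left (Fin.inject≤ p r≤l) i) i≡y)))
  f-p : f p ≡ i
  f-p = trans (cong (Perm.transpose y j ⟨$⟩ʳ_) (swap-left (Fin.inject≤ p r≤l) i)) (swap-other y j i≢y i≢j)

module Cliques (l : ℕ) (L : Vocabulary) (I : Subset (ρ L)) where

  open Extension l L I

  module _ {n : ℕ} (M : Structure L n) (γ : Colouring n) (γ◂M : γ ◂ M) where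

    module _ (x₀ : Fin n) (c : Fin l) where

      private
        occurs? : ∀ {r} (a : Vec (Fin (suc n)) r) → Dec (∃ λ p → lookup a p ≡ zero)
        occurs? a = Fin.any? λ p → lookup a p Fin.≟ zero

        lower : Fin (suc n) → Fin n
        -- A default value: `adjoin` lowers only tuples without `zero`.
        lower zero    = x₀
        lower (suc x) = x

        lower-suc : ∀ {r} (b : Vec (Fin n) r) → map lower (map suc b) ≡ b
        lower-suc b = trans (sym (map-∘ lower suc b)) (Vec.map-id b)

      -- The new vertex, of colour `c`, lies in every tuple that the colouring permits. Its type
      -- over `e` is the pattern whose realisation gives `full-vertex`.
      adjoin : Structure L (suc n)
      adjoin = record { interp = λ k a →
        if does (occurs? a) then does (rainbow? (lookup (c ∷ γ)) a) else interp M k (map lower a) }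

      adjoin-old : ∀ k b → interp adjoin k (map suc b) ≡ interp M k b
      adjoin-old k b with occurs? (map suc b)
      ... | yes (p , eq) = contradiction (trans (sym (lookup-map p suc b)) eq) λ ()
      ... | no _         = cong (interp M k) (lower-suc b)

      adjoin-new : ∀ k a → (∃ λ p → lookup a p ≡ zero) → Rainbow (lookup (c ∷ γ)) a → Holds adjoin k a
      adjoin-new k a occ rb with occurs? a
      ... | yes _   = dec-true (rainbow? (lookup (c ∷ γ)) a) rb
      ... | no ¬occ = contradiction occ ¬occ

      adjoin-cases : ∀ k a → Holds adjoin k a →
                     (∃ λ p → lookup a p ≡ zero) × Rainbow (lookup (c ∷ γ)) a ⊎ ∃ λ b → a ≡ map suc b × Holds M k b
      adjoin-cases k a h with occurs? a
      ... | yes occ = inj₁ (occ , witness (rainbow? (lookup (c ∷ γ)) a) h)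
        where
        witness : {X : Set} (d : Dec X) → does d ≡ true → X
        witness (yes x) _ = x
      ... | no ¬occ with b , refl ← lower-vec a (λ i eq → ¬occ (i , eq)) =
        inj₂ (b , refl , trans (cong (interp M k) (sym (lower-suc b))) h)

      adjoin-◂ : (c ∷ γ) ◂ adjoin
      adjoin-◂ = col , sy
        where
        col : StrongColouring l adjoin (lookup (c ∷ γ))
        col k a h with adjoin-cases k a h
        ... | inj₁ (_ , rb)       = rb
        ... | inj₂ (b , refl , h′) = proj₁ (rainbow-map (lookup (c ∷ γ)) (lookup γ) suc (λ _ → refl) b)
            (proj₁ γ◂M k b h′)
        sy : SymmetricOn adjoin
        sy k k∈I π a h with adjoin-cases k a h
        ... | inj₁ (occ , rb)      = adjoin-new k (permute π a) (occurs-permute π a occ)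
            (rainbow-permute (lookup (c ∷ γ)) π a rb)
        ... | inj₂ (b , refl , h′) = trans (cong (interp adjoin k) (sym (map-permute suc π b)))
                                           (trans (adjoin-old k (permute π b)) (proj₂ γ◂M k k∈I π b h′))

    FullOver : ∀ {m} → Fin n → Vec (Fin n) m → Set
    FullOver v e = ∀ k (t : Vec (Fin n) (arity L k)) → Within t (v ∷ e) → (∃ λ i → lookup t i ≡ v) →
                   Rainbow (lookup γ) t → Holds M k t

    module _ {m : ℕ} (e : Vec (Fin n) m) (x₀ : Fin n) (c : Fin l) where
      private
        kernel : Kernel (fresh e) (pull (fresh e) (adjoin x₀ c))
        kernel k t t′ eq = cong (interp (adjoin x₀ c) k) eq

        coloured : (c ∷ map (lookup γ) e) ◂ pull (fresh e) (adjoin x₀ c)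
        coloured = subst (_◂ pull (fresh e) (adjoin x₀ c)) (cong (c ∷_) (sym (map-∘ (lookup (c ∷ γ)) suc e)))
                         (pull-◂ {γ = c ∷ γ} (fresh e) (adjoin-◂ x₀ c))

        agrees : Agrees M e (pull (fresh e) (adjoin x₀ c))
        agrees k t = trans (cong (interp (adjoin x₀ c) k)
          (trans (sym (map-∘ (lookup (fresh e)) suc t))
                 (trans (map-cong (λ i → lookup-map i suc e) t) (map-∘ suc (lookup e) t))))
          (adjoin-old x₀ c k (map (lookup e) t))

      full-vertex : Ext m M γ → ∃ λ v → lookup γ v ≡ c × FullOver v e
      full-vertex ext with v , γv≡c , avoids , real ← ext⇒ {M = M} {γ} ext e c (pull (fresh e) (adjoin x₀ c))
          (coloured , kernel) agrees = v , γv≡c , full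
        where
        full : FullOver v e
        full k t within (i , ti≡v) rb = begin
          interp M k t                                        ≡⟨ cong (interp M k) t≡ ⟩
          interp M k (map (lookup (v ∷ e)) b)                 ≡⟨ real k b ⟩
          interp (adjoin x₀ c) k (map (lookup (fresh e)) b)   ≡⟨ adjoin-new x₀ c k _
              (i , trans (lookup-map i _ b) (cong (lookup (fresh e)) b-i))
                                                                   (proj₁ (rainbow-map (lookup (c ∷ γ))
                                                                       (lookup γ ∘ lookup (v ∷ e)) (lookup (fresh e))
                                                                       colour b)
                                                                     (proj₂ (rainbow-map (lookup γ) (lookup γ ∘ lookup
                                                                         (v ∷ e)) (lookup (v ∷ e)) (λ _ → refl) b)
                                                                         (subst (Rainbow (lookup γ)) t≡ rb))) ⟩
          true                                                ∎
          where
          open ≡-Reasoning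
          b : Vec (Fin (suc m)) (arity L k)
          b = tabulate (proj₁ ∘ within)
          t≡ : t ≡ map (lookup (v ∷ e)) b
          t≡ = lookup-ext λ i → sym (trans (lookup-map i (lookup (v ∷ e)) b)
                 (trans (cong (lookup (v ∷ e)) (lookup∘tabulate _ i)) (proj₂ (within i))))
          -- Since `v` avoids `e`, an occurrence of `v` in `t` comes from the new vertex of the
          -- pattern, where `adjoin` holds on rainbow tuples.
          only-zero : ∀ j → lookup (v ∷ e) j ≡ v → j ≡ zero
          only-zero zero    _  = refl
          only-zero (suc j) eq = contradiction eq (avoids j)
          b-i : lookup b i ≡ zero
          b-i = only-zero _ (trans (sym (lookup-map i (lookup (v ∷ e)) b))
              (trans (cong (λ u → lookup u i) (sym t≡)) ti≡v))
          colour : ∀ j → lookup (c ∷ γ) (lookup (fresh e) j) ≡ lookup γ (lookup (v ∷ e) j)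
          colour zero    = sym γv≡c
          colour (suc j) = cong (lookup (c ∷ γ)) (lookup-map j suc e)

    -- Each vertex is chosen full over `e` and all vertices chosen before it, so a tuple is settled
    -- by the last chosen vertex that it contains.
    full-tower : ∀ {m} p (cs : Vec (Fin l) p) (e : Vec (Fin n) m) → Fin n → (∀ q → q < p + m → Ext q M γ) →
                 ∃ λ (vs : Vec (Fin n) p) → (∀ i → lookup γ (lookup vs i) ≡ lookup cs i) ×
                   (∀ k (t : Vec (Fin n) (arity L k)) → Within t (vs ++ e) → (∃₂ λ i j → lookup t i ≡ lookup vs j) →
                    Rainbow (lookup γ) t → Holds M k t)
    full-tower zero    []       e x₀ ext = [] , (λ ()) , λ where k t _ (_ , () , _)
    full-tower {m} (suc p) (c ∷ cs) e x₀ ext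
      with vs , colours , full ← full-tower p cs e x₀ (λ q q< → ext q (m≤n⇒m≤1+n q<))
      with v , γv≡c , full-v ← full-vertex (vs ++ e) x₀ c (ext (p + m) ≤-refl) =
      v ∷ vs , (λ where zero → γv≡c ; (suc i) → colours i) , full′
      where
      full′ : ∀ k (t : Vec (Fin n) (arity L k)) → Within t (v ∷ vs ++ e) → (∃₂ λ i j → lookup t i ≡ lookup (v ∷ vs) j) →
              Rainbow (lookup γ) t → Holds M k t
      full′ k t within (i , j , eq) rb with Fin.any? (λ i → lookup t i Fin.≟ v)
      ... | yes occ = full-v k t within occ rb
      ... | no ¬occ = full k t within′ (i , below j eq) rb
        where
        within′ : Within t (vs ++ e)
        within′ i with within i
        ... | zero  , eq = contradiction (i , sym eq) ¬occ
        ... | suc j , eq = j , eq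
        below : ∀ j → lookup t i ≡ lookup (v ∷ vs) j → ∃ λ j → lookup t i ≡ lookup vs j
        below zero    eq = contradiction (i , eq) ¬occ
        below (suc j) eq = j , eq

  module Relation (R : Fin (ρ L)) (2≤r : 2 ≤ arity L R) (r≤l : arity L R ≤ l) where
    private
      r = arity L R
      p₀ p₁ : Fin r
      p₀ = Fin.fromℕ< (≤-trans (n≤1+n 1) 2≤r)
      p₁ = Fin.fromℕ< 2≤r
      p₀≢p₁ : p₀ ≢ p₁
      p₀≢p₁ eq = contradiction (trans (sym (Fin.toℕ-fromℕ< _)) (trans (cong toℕ eq) (Fin.toℕ-fromℕ< 2≤r))) λ ()

    Clique : ∀ {n} → Structure L n → (Fin l → Fin n) → Set
    Clique M d = ∀ (s : Vec (Fin l) r) → Rainbow id s → Holds M R (map d s)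

    -- Any two places of the clique occur together in an injective tuple, which lies in `R`; this is
    -- where the arity must be at least 2 and at most `l`.
    clique-injective : ∀ {n} (M : Structure L n) (γ : Fin n → Fin l) {d} → StrongColouring l M γ → Clique M d →
                       ∀ i j → i ≢ j → γ (d i) ≢ γ (d j)
    clique-injective M γ {d} col clique i j i≢j eq with s , rb , refl , refl ← injection-through r≤l p₀≢p₁ i≢j =
      col R (map d s) (clique s rb) p₀ p₁ p₀≢p₁
        (trans (cong γ (lookup-map p₀ d s)) (trans eq (cong γ (sym (lookup-map p₁ d s)))))

    -- Each clique uses every colour, so cliques that differ in one place have the same colour there.
    cliques-agree : ∀ {n} (M : Structure L n) (γ : Fin n → Fin l) {d d′} → StrongColouring l M γ → Clique M d →
        Clique M d′ →
                    ∀ i → (∀ j → j ≢ i → d j ≡ d′ j) → γ (d i) ≡ γ (d′ i)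
    cliques-agree M γ {d} {d′} col clique clique′ i same
      with j , eq ← injective⇒surjective (γ ∘ d′) (clique-injective M γ col clique′) (γ (d i)) | j Fin.≟ i
    ... | yes refl = sym eq
    ... | no j≢i   = contradiction (trans (cong γ (same j j≢i)) eq) (clique-injective M γ col clique j i j≢i)

    -- Choosing `l` vertices one by one over the pair `a`, `b` extends tuples of length at most
    -- `l + 1`; hence the bound `l + 2`.
    module Good {n : ℕ} (M : Structure L n) (γ : Colouring n) (γ◂M : γ ◂ M) (ext : ∀ q → q < l + 2 → Ext q M γ) where

      rainbow-clique : ∀ a b → ∃ λ (vs : Vec (Fin n) l) → (∀ i → lookup γ (lookup vs i) ≡ i) ×
        (∀ d i → (∀ j → j ≢ i → d j ≡ lookup vs j) → (∃ λ j → lookup (vs ++ a ∷ b ∷ []) j ≡ d i) → lookup γ (d i) ≡ i →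
            Clique M d)
      rainbow-clique a b with vs , colours , full ← full-tower M γ γ◂M l (tabulate id) (a ∷ b ∷ []) a ext =
        vs , colours′ , clique
        where
        colours′ : ∀ i → lookup γ (lookup vs i) ≡ i
        colours′ i = trans (colours i) (lookup∘tabulate id i)
        clique : ∀ d i → (∀ j → j ≢ i → d j ≡ lookup vs j) → (∃ λ j → lookup (vs ++ a ∷ b ∷ []) j ≡ d i) → lookup γ
            (d i) ≡ i → Clique M d
        clique d i old new γdi≡i s rb = full R (map d s) within meets
          (proj₁ (rainbow-map (lookup γ) id d colour s) rb)
          where
          within : Within (map d s) (vs ++ a ∷ b ∷ [])
          within p with lookup s p Fin.≟ i
          ... | yes sp≡i = proj₁ new , trans (proj₂ new) (trans (cong d (sym sp≡i)) (sym (lookup-map p d s)))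
          ... | no sp≢i  = lookup s p Fin.↑ˡ 2 , trans (Vec.lookup-++ˡ vs _ (lookup s p))
                             (trans (sym (old _ sp≢i)) (sym (lookup-map p d s)))
          at : ∀ p → lookup s p ≢ i → lookup (map d s) p ≡ lookup vs (lookup s p)
          at p sp≢i = trans (lookup-map p d s) (old _ sp≢i)
          -- Of two different positions at most one carries the exchanged place `i`; the other one
          -- holds a vertex of the tower.
          meets : ∃₂ λ p j → lookup (map d s) p ≡ lookup vs j
          meets with lookup s p₀ Fin.≟ i
          ... | no sp₀≢i  = p₀ , lookup s p₀ , at p₀ sp₀≢i
          ... | yes sp₀≡i = p₁ , lookup s p₁ , at p₁ (λ sp₁≡i → rb p₀ p₁ p₀≢p₁ (trans sp₀≡i (sym sp₁≡i)))
          colour : ∀ j → lookup γ (d j) ≡ j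
          colour j with j Fin.≟ i
          ... | yes refl = γdi≡i
          ... | no j≢i   = trans (cong (lookup γ) (old j j≢i)) (colours′ j)

      exchange : ∀ a b → ∃ λ (c : Fin l → Fin n) → (∀ i → lookup γ (c i) ≡ i) × Clique M c ×
                 Clique M (update c (lookup γ a) a) × Clique M (update c (lookup γ b) b)
      exchange a b with vs , colours , clique ← rainbow-clique a b =
        lookup vs , colours ,
        clique (lookup vs) (lookup γ a) (λ _ _ → refl) (lookup γ a Fin.↑ˡ 2 , Vec.lookup-++ˡ vs _ (lookup γ a))
            (colours _) ,
        replace a (l Fin.↑ʳ zero) (Vec.lookup-++ʳ vs (a ∷ b ∷ []) zero) ,
        replace b (l Fin.↑ʳ suc zero) (Vec.lookup-++ʳ vs (a ∷ b ∷ []) (suc zero))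
        where
        replace : ∀ x j → lookup (vs ++ a ∷ b ∷ []) j ≡ x → Clique M (update (lookup vs) (lookup γ x) x)
        replace x j eq = clique _ (lookup γ x) (λ _ → update-other (lookup vs) (lookup γ x) x)
          (j , trans eq (sym (update-at (lookup vs) (lookup γ x) x)))
              (cong (lookup γ) (update-at (lookup vs) (lookup γ x) x))

      module _ {γ′ : Fin n → Fin l} (col′ : StrongColouring l M γ′) where

        same⇒same′ : ∀ a b → lookup γ a ≡ lookup γ b → γ′ a ≡ γ′ b
        same⇒same′ a b eq with c , _ , _ , clique-a , clique-b ← exchange a b rewrite eq =
          subst₂ (λ x y → γ′ x ≡ γ′ y) (update-at c (lookup γ b) a) (update-at c (lookup γ b) b)
            (cliques-agree M γ′ col′ clique-a clique-b (lookup γ b) λ j j≢ → trans (update-other c (lookup γ b) a j≢)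
                (sym (update-other c (lookup γ b) b j≢)))

        -- Exchanging shows that `a` and `b` have under `γ′` the colours of the vertices of `c` at
        -- places `lookup γ a` and `lookup γ b`. Different places of a clique have different
        -- colours.
        same′⇒same : ∀ a b → γ′ a ≡ γ′ b → lookup γ a ≡ lookup γ b
        same′⇒same a b eq with c , _ , clique-c , clique-a , clique-b ← exchange a b =
          decidable-stable (lookup γ a Fin.≟ lookup γ b) λ a≢b →
            clique-injective M γ′ col′ clique-c _ _ a≢b (trans (sym (to-c a clique-a)) (trans eq (to-c b clique-b)))
          where
          to-c : ∀ x → Clique M (update c (lookup γ x) x) → γ′ x ≡ γ′ (c (lookup γ x))
          to-c x clique-x = subst (λ y → γ′ y ≡ γ′ (c (lookup γ x))) (update-at c (lookup γ x) x)
            (cliques-agree M γ′ col′ clique-x clique-c (lookup γ x) λ j → update-other c (lookup γ x) x)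

      unique-colouring : UniquelyStronglyColourable l M
      unique-colouring = (lookup γ , proj₁ γ◂M) , λ γ₁ γ₂ col₁ col₂ a b →
        mk⇔ (same⇒same′ col₂ a b ∘ same′⇒same col₁ a b) (same⇒same′ col₁ a b ∘ same′⇒same col₂ a b)

      -- Any colouring is `γ` followed by a map of colours, which can be read off from the clique
      -- `c` with one vertex of each colour.
      colourings-bounded : count (_◂? M) (colourings n) ≤ l ^ l
      colourings-bounded = ≤-trans
        (count≤length (setoid (Colouring n)) (_◂? M) (tuples-unique l n)
            (List.map (λ π → map (lookup π) γ) (tuples l l)) λ γ′ γ′◂M → listed n refl γ′ γ′◂M)
        (≤-reflexive (trans (List.length-map _ (tuples l l)) (length-tuples l l)))
        where
        -- The size is split off because `exchange` needs a vertex; on the empty universe there is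
        -- only the empty colouring.
        listed : ∀ n′ → n ≡ n′ → ∀ γ′ → γ′ ◂ M → γ′ ∈ List.map (λ π → map (lookup π) γ) (tuples l l)
        listed zero    refl γ′ _ = subst (_∈ _) (lookup-ext λ ())
            (∈-map⁺ (λ π → map (lookup π) γ) (tuples-complete (tabulate id)))
        listed (suc _) refl γ′ γ′◂M with c , colours , _ ← exchange zero zero =
          subst (_∈ _) (lookup-ext λ x → begin
              lookup (map (lookup (π c)) γ) x       ≡⟨ lookup-map x (lookup (π c)) γ ⟩
              lookup (π c) (lookup γ x)             ≡⟨ lookup∘tabulate (λ i → lookup γ′ (c i)) (lookup γ x) ⟩
              lookup γ′ (c (lookup γ x))            ≡⟨ same⇒same′ (proj₁ γ′◂M) _ x (colours (lookup γ x)) ⟩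
              lookup γ′ x                           ∎)
            (∈-map⁺ (λ π → map (lookup π) γ) (tuples-complete (π c)))
          where
          open ≡-Reasoning
          π : (Fin l → Fin n) → Vec (Fin l) l
          π c = tabulate λ i → lookup γ′ (c i)

    -- A formula for equality of colours

    ⊤′ : ∀ {m} → Formula L m
    ⊤′ = ∀′ (zero ≐ zero)

    ⋀ ⋁ : ∀ {m} → List (Formula L m) → Formula L m
    ⋀ = List.foldr _∧′_ ⊤′
    ⋁ = List.foldr _∨′_ (¬′ ⊤′)

    ∃^ : ∀ p {m} → Formula L (p + m) → Formula L m
    ∃^ zero    φ = φ
    ∃^ (suc p) φ = ∃^ p (∃′ φ)

    module _ {n : ℕ} {M : Structure L n} where

      ⋀-sound : ∀ {m} {e : Vec (Fin n) m} φs → M ⊨ ⋀ φs [ e ] → All (λ φ → M ⊨ φ [ e ]) φs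
      ⋀-sound []       _       = []
      ⋀-sound (φ ∷ φs) (p , q) = p ∷ ⋀-sound φs q

      ⋀-complete : ∀ {m} {e : Vec (Fin n) m} {φs} → All (λ φ → M ⊨ φ [ e ]) φs → M ⊨ ⋀ φs [ e ]
      ⋀-complete []       = λ _ → refl
      ⋀-complete (p ∷ ps) = p , ⋀-complete ps

      ⋁-sound : ∀ {m} {e : Vec (Fin n) m} φs → M ⊨ ⋁ φs [ e ] → Any (λ φ → M ⊨ φ [ e ]) φs
      ⋁-sound []       ¬⊤       = contradiction (λ _ → refl) ¬⊤
      ⋁-sound (φ ∷ φs) (inj₁ p) = here p
      ⋁-sound (φ ∷ φs) (inj₂ p) = there (⋁-sound φs p)

      ⋁-complete : ∀ {m} {e : Vec (Fin n) m} {φs} → Any (λ φ → M ⊨ φ [ e ]) φs → M ⊨ ⋁ φs [ e ]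
      ⋁-complete (here p)  = inj₁ p
      ⋁-complete (there p) = inj₂ (⋁-complete p)

      ∃^-sound : ∀ p {m} {e : Vec (Fin n) m} (φ : Formula L (p + m)) → M ⊨ ∃^ p φ [ e ] → ∃ λ vs → M ⊨ φ [ vs ++ e ]
      ∃^-sound zero    φ h = [] , h
      ∃^-sound (suc p) φ h with vs , v , h′ ← ∃^-sound p (∃′ φ) h = v ∷ vs , h′

      ∃^-complete : ∀ p {m} {e : Vec (Fin n) m} (φ : Formula L (p + m)) vs → M ⊨ φ [ vs ++ e ] → M ⊨ ∃^ p φ [ e ]
      ∃^-complete zero    φ []       h = h
      ∃^-complete (suc p) φ (v ∷ vs) h = ∃^-complete p (∃′ φ) vs (v , h)

    private
      injections : List (Vec (Fin l) r)
      injections = filter (rainbow? id) (tuples l r)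

    clique′ : ∀ {m} → (Fin l → Fin m) → Formula L m
    clique′ w = ⋀ (List.map (λ s → rel R (map w s)) injections)

    module _ {n m : ℕ} {M : Structure L n} {e : Vec (Fin n) m} (w : Fin l → Fin m) {d : Fin l → Fin n}
             (values : ∀ j → lookup e (w j) ≡ d j) where
      private
        evaluate : ∀ s → map (lookup e) (map {n = r} w s) ≡ map d s
        evaluate s = trans (sym (map-∘ (lookup e) w s)) (map-cong values s)

      clique′-sound : M ⊨ clique′ w [ e ] → Clique M d
      clique′-sound h s rb = subst (Holds M R) (evaluate s)
        (All.lookup (All.map⁻ (⋀-sound (List.map (λ s → rel R (map w s)) injections) h))
            (∈-filter⁺ (rainbow? id) (tuples-complete s) rb))

      clique′-complete : Clique M d → M ⊨ clique′ w [ e ]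
      clique′-complete clique = ⋀-complete {φs = List.map (λ s → rel R (map w s)) injections}
          (All.map⁺ (All.tabulate λ {s} s∈ →
        subst (Holds M R) (sym (evaluate s)) (clique s (proj₂ (∈-filter⁻ (rainbow? id) {xs = tuples l r} s∈)))))

    -- Variables 0, …, l − 1 stand for the vertices of a clique; l and l + 1 stand for the free variables of ξ.
    exchangeable : Fin l → Formula L (l + 2)
    exchangeable i = clique′ (update (Fin._↑ˡ 2) i (l Fin.↑ʳ zero)) ∧′ clique′
        (update (Fin._↑ˡ 2) i (l Fin.↑ʳ suc zero))

    -- The quantified vertex at the exchanged place is a placeholder: both cliques override it.
    ξ : Formula L 2
    ξ = ∃^ l (⋁ (List.map exchangeable (allFin l)))

    module _ {n : ℕ} {M : Structure L n} (a b : Fin n) where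
      private
        values : ∀ (vs : Vec (Fin n) l) i z {x} → lookup (a ∷ b ∷ []) z ≡ x → ∀ j →
                 lookup (vs ++ a ∷ b ∷ []) (update (Fin._↑ˡ 2) i (l Fin.↑ʳ z) j) ≡ update (lookup vs) i x j
        values vs i z refl j with j Fin.≟ i
        ... | yes _ = Vec.lookup-++ʳ vs (a ∷ b ∷ []) z
        ... | no _  = Vec.lookup-++ˡ vs (a ∷ b ∷ []) j

      ξ-sound : M ⊨ ξ [ a ∷ b ∷ [] ] → ∃₂ λ (c : Fin l → Fin n) i → Clique M (update c i a) × Clique M (update c i b)
      ξ-sound h with vs , h′ ← ∃^-sound l (⋁ (List.map exchangeable (allFin l))) h
        with i , p , q ← Any.satisfied (Any.map⁻ (⋁-sound (List.map exchangeable (allFin l)) h′)) =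
        lookup vs , i , clique′-sound _ (values vs i zero refl) p , clique′-sound _ (values vs i (suc zero) refl) q

      ξ-complete : ∀ (c : Fin l → Fin n) i → Clique M (update c i a) → Clique M (update c i b) → M ⊨ ξ [ a ∷ b ∷ [] ]
      ξ-complete c i p q = ∃^-complete l (⋁ (List.map exchangeable (allFin l))) (tabulate c)
        (⋁-complete {φs = List.map exchangeable (allFin l)} (Any.map⁺ (lose (∈-allFin i)
          ( clique′-complete _ (λ j → trans (values (tabulate c) i zero refl j) (retabulate a j)) p
          , clique′-complete _ (λ j → trans (values (tabulate c) i (suc zero) refl j) (retabulate b j)) q))))
        where
        retabulate : ∀ x j → update (lookup (tabulate c)) i x j ≡ update c i x j
        retabulate x j with j Fin.≟ i
        ... | yes _ = refl
        ... | no _  = lookup∘tabulate c j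

    -- That `ξ` implies equal colours follows from `cliques-agree` alone; the extension properties
    -- supply the cliques for the other direction.
    ξ-defines : ∀ {n} (M : Structure L n) (γ : Colouring n) → γ ◂ M → (∀ q → q < l + 2 → Ext q M γ) →
                (γ′ : Fin n → Fin l) → StrongColouring l M γ′ → ∀ a b → (γ′ a ≡ γ′ b) ⇔ (M ⊨ ξ [ a ∷ b ∷ [] ])
    ξ-defines M γ γ◂M ext γ′ col′ a b = mk⇔ to from
      where
      open Good M γ γ◂M ext
      to : γ′ a ≡ γ′ b → M ⊨ ξ [ a ∷ b ∷ [] ]
      to eq with same ← same′⇒same col′ a b eq with c , _ , _ , clique-a , clique-b ← exchange a b =
        ξ-complete a b c (lookup γ b) (subst (λ i → Clique M (update c i a)) same clique-a) clique-b
      from : M ⊨ ξ [ a ∷ b ∷ [] ] → γ′ a ≡ γ′ b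
      from h with c , i , clique-a , clique-b ← ξ-sound a b h =
        subst₂ (λ x y → γ′ x ≡ γ′ y) (update-at c i a) (update-at c i b)
          (cliques-agree M γ′ col′ clique-a clique-b i λ j j≢i → trans (update-other c i a j≢i)
              (sym (update-other c i b j≢i)))

-- Ehrenfeucht–Fraïssé games

module Games (l : ℕ) (L : Vocabulary) (I : Subset (ρ L)) where

  open Extension l L I

  qr : ∀ {m} → Formula L m → ℕ
  qr (x ≐ y)   = 0
  qr (rel k t) = 0
  qr (¬′ φ)    = qr φ
  qr (φ ∧′ ψ)  = qr φ ⊔ qr ψ
  qr (φ ∨′ ψ)  = qr φ ⊔ qr ψ
  qr (φ ⇒′ ψ)  = qr φ ⊔ qr ψ
  qr (∀′ φ)    = suc (qr φ)
  qr (∃′ φ)    = suc (qr φ)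

  record Side (R : ℕ) : Set where
    field
      {size}    : ℕ
      structure : Structure L size
      colouring : Colouring size
      coloured  : colouring ◂ structure
      ext       : ∀ q → q < R → Ext q structure colouring

  open Side

  -- A partial isomorphism that also keeps the names of colours, although the language does not see
  -- them. This makes the type of a further element an admissible pattern on the other side.
  record Position {R m} (A B : Side R) (d : Vec (Fin (size A)) m) (e : Vec (Fin (size B)) m) : Set where
    field
      preserve   : ∀ i j → lookup d i ≡ lookup d j → lookup e i ≡ lookup e j
      reflect  : ∀ i j → lookup e i ≡ lookup e j → lookup d i ≡ lookup d j
      atoms   : ∀ k (t : Vec (Fin m) (arity L k)) → interp (structure A) k (map (lookup d) t) ≡ interp (structure B) k
          (map (lookup e) t)
      colours : ∀ i → lookup (colouring A) (lookup d i) ≡ lookup (colouring B) (lookup e i)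

  flip-position : ∀ {R m} {A B : Side R} {d : Vec (Fin (size A)) m} {e} → Position A B d e → Position B A e d
  flip-position p = record
    { preserve = reflect ; reflect = preserve ; atoms = λ k t → sym (atoms k t) ; colours = λ i → sym (colours i) }
    where open Position p

  module _ {R m} {A B : Side R} {d : Vec (Fin (size A)) m} {e : Vec (Fin (size B)) m} (p : Position A B d e) where
    open Position p

    repeat : ∀ i → Position A B (lookup d i ∷ d) (lookup e i ∷ e)
    repeat i = record
      { preserve   = λ x y eq → trans (at e x)
          (trans (preserve _ _ (trans (sym (at d x)) (trans eq (at d y)))) (sym (at e y)))
      ; reflect  = λ x y eq → trans (at d x)
          (trans (reflect _ _ (trans (sym (at e x)) (trans eq (at e y)))) (sym (at d y)))
      ; atoms   = λ k t → trans (cong (interp (structure A) k) (at-tuple d t))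
                            (trans (atoms k (map old t)) (cong (interp (structure B) k) (sym (at-tuple e t))))
      ; colours = λ x → trans (cong (lookup (colouring A)) (at d x))
                            (trans (colours (old x)) (cong (lookup (colouring B)) (sym (at e x))))
      }
      where
      old : Fin (suc m) → Fin m
      old zero    = i
      old (suc j) = j
      at : ∀ {n} (f : Vec (Fin n) m) x → lookup (lookup f i ∷ f) x ≡ lookup f (old x)
      at f zero    = refl
      at f (suc j) = refl
      at-tuple : ∀ {n r} (f : Vec (Fin n) m) (t : Vec (Fin (suc m)) r) → map (lookup (lookup f i ∷ f)) t ≡ map
          (lookup f) (map old t)
      at-tuple f t = trans (map-cong (at f) t) (map-∘ (lookup f) old t)

    private
      same-colours : map (lookup (colouring A)) d ≡ map (lookup (colouring B)) e
      same-colours = lookup-ext λ i → trans (lookup-map i _ d) (trans (colours i) (sym (lookup-map i _ e)))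
      kernel : ∀ a → Kernel (fresh e) (pull (a ∷ d) (structure A))
      kernel a k t t′ eq = cong (interp (structure A) k) (lookup-transfer {d = fresh e} {a ∷ d} σ t t′ eq)
        where
        σ : ∀ i j → lookup (fresh e) i ≡ lookup (fresh e) j → lookup (a ∷ d) i ≡ lookup (a ∷ d) j
        σ zero    zero    _  = refl
        σ zero    (suc j) eq = contradiction (trans eq (lookup-map j suc e)) λ ()
        σ (suc i) zero    eq = contradiction (trans (sym (lookup-map i suc e)) eq) λ ()
        σ (suc i) (suc j) eq = reflect i j
            (Fin.suc-injective (trans (sym (lookup-map i suc e)) (trans eq (lookup-map j suc e))))

    -- If `a` is new, its type over `d` is a pattern over `e` for the colour of `a`, and an
    -- extension property of `B` realises it outside `e`.
    forth : m < R → ∀ a → ∃ λ b → Position A B (a ∷ d) (b ∷ e)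
    forth m<R a with Fin.any? (λ i → lookup d i Fin.≟ a)
    ... | yes (i , refl) = lookup e i , repeat i
    ... | no new with b , γb≡c , avoids , realises ← ext⇒ {M = structure B} {colouring B} (ext B m m<R) e
        (lookup (colouring A) a) (pull (a ∷ d) (structure A))
                       (subst (_◂ pull (a ∷ d) (structure A)) (cong (lookup (colouring A) a ∷_) same-colours)
                           (pull-◂ {γ = colouring A} (a ∷ d) (coloured A)) , kernel a)
                       (λ k t → trans (cong (interp (structure A) k) (sym (map-∘ (lookup (a ∷ d)) suc t)))
                           (atoms k t)) = b , record
      { preserve   = λ where
          zero    zero    _  → refl
          zero    (suc j) eq → contradiction (j , sym eq) new
          (suc i) zero    eq → contradiction (i , eq) new
          (suc i) (suc j) eq → preserve i j eq
      ; reflect  = λ where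
          zero    zero    _  → refl
          zero    (suc j) eq → contradiction (sym eq) (avoids j)
          (suc i) zero    eq → contradiction eq (avoids i)
          (suc i) (suc j) eq → reflect i j eq
      ; atoms   = λ k t → sym (realises k t)
      ; colours = λ where
          zero    → sym γb≡c
          (suc i) → colours i
      }

  private
    ⊔-left : ∀ {R} m {m₁ m₂} (φ : Formula L m₁) (ψ : Formula L m₂) → m + (qr φ ⊔ qr ψ) ≤ R → m + qr φ ≤ R
    ⊔-left m φ ψ = ≤-trans (+-monoʳ-≤ m (m≤m⊔n (qr φ) (qr ψ)))

    ⊔-right : ∀ {R} m {m₁ m₂} (φ : Formula L m₁) (ψ : Formula L m₂) → m + (qr φ ⊔ qr ψ) ≤ R → m + qr ψ ≤ R
    ⊔-right m φ ψ = ≤-trans (+-monoʳ-≤ m (m≤n⊔m (qr φ) (qr ψ)))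

    room : ∀ {R} m {m₁} (φ : Formula L m₁) → m + suc (qr φ) ≤ R → m < R
    room m φ = ≤-trans (≤-trans (s≤s (m≤m+n m (qr φ))) (≤-reflexive (sym (+-suc m (qr φ)))))

  transfer : ∀ {R m} {A B : Side R} (φ : Formula L m) → m + qr φ ≤ R →
      {d : Vec (Fin (size A)) m} {e : Vec (Fin (size B)) m} →
             Position A B d e → structure A ⊨ φ [ d ] → structure B ⊨ φ [ e ]
  transfer (x ≐ y)   le p h        = Position.preserve p x y h
  transfer (rel k t) le p h        = trans (sym (Position.atoms p k t)) h
  transfer (¬′ φ)    le p h        = λ h′ → h (transfer φ le (flip-position p) h′)
  transfer {m = m} (φ ∧′ ψ) le p (h , h′)  = transfer φ (⊔-left m φ ψ le) p h , transfer ψ (⊔-right m φ ψ le) p h′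
  transfer {m = m} (φ ∨′ ψ) le p (inj₁ h)  = inj₁ (transfer φ (⊔-left m φ ψ le) p h)
  transfer {m = m} (φ ∨′ ψ) le p (inj₂ h)  = inj₂ (transfer ψ (⊔-right m φ ψ le) p h)
  transfer {m = m} (φ ⇒′ ψ) le p h         = λ h′ → transfer ψ (⊔-right m φ ψ le) p
      (h (transfer φ (⊔-left m φ ψ le) (flip-position p) h′))
  transfer {R} {m} (∀′ φ) le p h b with a , p′ ← forth (flip-position p) (room m φ le) b =
    transfer φ (≤-trans (≤-reflexive (sym (+-suc m (qr φ)))) le) (flip-position p′) (h a)
  transfer {R} {m} (∃′ φ) le p (a , h) with b , p′ ← forth p (room m φ le) a =
    b , transfer φ (≤-trans (≤-reflexive (sym (+-suc m (qr φ)))) le) p′ h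

-- Zero-one law

-- The distance is `k / c`, and a positive `ε` is at least the reciprocal of its denominator. The
-- factor 2 makes the inequality strict.
ratio-close : ∀ p k c .{{_ : NonZero c}} → p + k ≡ c → ∀ ε → 0ℚ ℚ.< ε → 2 * ℚ.↧ₙ ε * k ≤ c →
              ℚ.∣ (ℤ.+ p) ℚ./ c ℚ.- 1ℚ ∣ ℚ.< ε
ratio-close p k (suc c) eq (ℚ.mkℚ (ℤ.+ zero) d _)  (ℚ.*<* (ℤ.+<+ ())) small
ratio-close p k (suc c) eq (ℚ.mkℚ ℤ.-[1+ _ ] d _) (ℚ.*<* ()) small
ratio-close p k (suc c) eq ε@(ℚ.mkℚ (ℤ.+ suc a) d _) ε>0 small = ℚ.toℚᵘ-cancel-< (begin-strict
  ℚ.toℚᵘ ℚ.∣ x ℚ.- 1ℚ ∣                              ≃⟨ ℚ.toℚᵘ-homo-∣-∣ (x ℚ.- 1ℚ) ⟩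
  ℚᵘ.∣ ℚ.toℚᵘ (x ℚ.- 1ℚ) ∣                           ≃⟨ ℚᵘ.∣-∣-cong (ℚ.toℚᵘ-homo-+ x (ℚ.- 1ℚ)) ⟩
  ℚᵘ.∣ ℚ.toℚᵘ x ℚᵘ.+ ℚ.toℚᵘ (ℚ.- 1ℚ) ∣               ≃⟨ ℚᵘ.∣-∣-cong
      (ℚᵘ.+-congˡ (ℚ.toℚᵘ (ℚ.- 1ℚ)) (ℚ.toℚᵘ-fromℚᵘ (ℚᵘ.mkℚᵘ (ℤ.+ p) c))) ⟩
  ℚᵘ.∣ ℚᵘ.mkℚᵘ (ℤ.+ p) c ℚᵘ.+ ℚ.toℚᵘ (ℚ.- 1ℚ) ∣      <⟨ ℚᵘ.*<* (subst₂ ℤ._<_ left right (ℤ.+<+ bound)) ⟩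
  ℚ.toℚᵘ ε                                           ∎)
  where
  open ℚᵘ.≤-Reasoning
  x = (ℤ.+ p) ℚ./ suc c
  numerator : ℤ
  numerator = ℤ.+ p ℤ.* ℤ.+ 1 ℤ.+ ℤ.-[1+ 0 ] ℤ.* ℤ.+ suc c
  ∣numerator∣ : ℤ.∣ numerator ∣ ≡ k
  ∣numerator∣ = trans (cong ℤ.∣_∣
      (trans (cong₂ ℤ._+_ (ℤ.*-identityʳ (ℤ.+ p)) (ℤ.-1*i≡-i (ℤ.+ suc c))) (ℤ.m-n≡m⊖n p (suc c))))
    (trans (ℤ.∣⊖∣-≤ (≤-trans (m≤m+n p k) (≤-reflexive eq))) (trans (cong (_∸ p) (sym eq)) (m+n∸m≡n p k)))
  bound : k * suc d < suc a * (suc c * 1)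
  bound = double (k * suc d) (≤-trans (≤-reflexive (regroup k (suc d))) small)
    where
    regroup : ∀ k d → k * d + k * d ≡ 2 * d * k
    regroup = solve-∀
    double : ∀ y → y + y ≤ suc c → y < suc a * (suc c * 1)
    double zero    _ = s≤s z≤n
    double (suc y) h = ≤-trans (≤-trans (+-monoˡ-≤ (suc y) (s≤s z≤n)) h)
      (≤-trans (≤-reflexive (sym (*-identityʳ (suc c)))) (m≤m+n (suc c * 1) _))
  left : ℤ.+ (k * suc d) ≡ ℤ.+ ℤ.∣ numerator ∣ ℤ.* ℤ.+ suc d
  left = trans (ℤ.pos-* k (suc d)) (cong (λ z → ℤ.+ z ℤ.* ℤ.+ suc d) (sym ∣numerator∣))
  right : ℤ.+ (suc a * (suc c * 1)) ≡ ℤ.+ suc a ℤ.* ℤ.+ (suc c * 1)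
  right = ℤ.pos-* (suc a) (suc c * 1)

-- From coloured pairs to proportions of structures

module Limits (l : ℕ) (2≤l : 2 ≤ l) (L : Vocabulary) (I : Subset (ρ L)) (R : Fin (ρ L))
              (2≤arity : ∀ k → 2 ≤ arity L k) (arity≤l : ∀ k → arity L k ≤ l) where

  open Asymptotics l L I
  open Cliques l L I
  open Relation R (2≤arity R) (arity≤l R)
  open Games l L I

  AllExt : ∀ {n} → ℕ → Structure L n → Colouring n → Set
  AllExt b M γ = ∀ (q : Fin b) → Ext (toℕ q) M γ

  allExt⇒ : ∀ {n b} (M : Structure L n) (γ : Colouring n) → AllExt b M γ → ∀ q → q < b → Ext q M γ
  allExt⇒ M γ ext q q<b = subst (λ q → Ext q M γ) (Fin.toℕ-fromℕ< q<b) (ext (Fin.fromℕ< q<b))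

  Generic : ∀ {n} → ℕ → Structure L n → Set
  Generic {n} b M = ∃ λ (γ : Colouring n) → γ ◂ M × AllExt b M γ

  abstract
    generic? : ∀ {n} b (M : Structure L n) → Dec (Generic b M)
    generic? {n} b M = map′ (λ p → let γ , _ , h = find p in γ , h) (λ (γ , h) → lose (tuples-complete γ) h)
      (Any.any? (λ γ → (γ ◂? M) ×-dec Fin.all? λ q → ext? (toℕ q) M γ) (colourings n))

  numS : ℕ → ℕ
  numS n = count inS? (structures n)

  private
    empty : ∀ n → Structure L n
    empty n = record { interp = λ _ _ → false }

    empty-inS : ∀ n → InS l I (empty n)
    empty-inS n = ◂⇒inS (Vec.replicate n (Fin.fromℕ< (≤-trans (n≤1+n 1) 2≤l))) ((λ _ _ ()) , λ _ _ _ _ ())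

  numS>0 : ∀ n → 0 < numS n
  numS>0 n = let M , M∈ , E≈M = find (structures-complete (empty n)) in
    ≤-trans (≤-reflexive (sym (𝟙-yes (inS-resp E≈M (empty-inS n)) (inS? M)))) (∈⇒≤∑ (λ M → 𝟙 (inS? M)) M∈)

  module _ (b : ℕ) (l+2≤b : l + 2 ≤ b) where

    numGeneric numSpecial : ℕ → ℕ
    numGeneric n = count (generic? b) (structures n)
    numSpecial n = count (λ M → inS? M ×-dec ¬? (generic? b M)) (structures n)

    private
      fail : ∀ {n} → Colouring n → Structure L n → ℕ
      fail γ M = ∑ (allFin b) (λ q → 𝟙 (fails? (toℕ q) γ M))

      numFail : ℕ → ℕ
      numFail n = ∑ (allFin b) (λ q → fails (toℕ q) n)

      numFail≡ : ∀ n → ∑ (structures n) (λ M → ∑ (colourings n) (λ γ → fail γ M)) ≡ numFail n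
      numFail≡ n = begin
        ∑ (structures n) (λ M → ∑ (colourings n) (λ γ → fail γ M))
          ≡⟨ ∑-cong (structures n) (λ M → ∑-swap (colourings n) (allFin b) (λ γ q → 𝟙 (fails? (toℕ q) γ M))) ⟩
        ∑ (structures n) (λ M → ∑ (allFin b) (λ q → ∑ (colourings n) (λ γ → 𝟙 (fails? (toℕ q) γ M))))
          ≡⟨ ∑-swap (structures n) (allFin b) (λ M q → ∑ (colourings n) (λ γ → 𝟙 (fails? (toℕ q) γ M))) ⟩
        ∑ (allFin b) (λ q → ∑ (structures n) (λ M → ∑ (colourings n) (λ γ → 𝟙 (fails? (toℕ q) γ M))))
          ≡⟨ ∑-cong (allFin b) (λ q → ∑-swap (structures n) (colourings n) (λ M γ → 𝟙 (fails? (toℕ q) γ M))) ⟩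
        numFail n ∎
        where open ≡-Reasoning

      not-generic : ∀ {n} {M : Structure L n} γ → γ ◂ M → ¬ Generic b M → 1 ≤ fail γ M
      not-generic {M = M} γ γ◂M ¬generic =
        let q , ¬ext = Fin.¬∀⟶∃¬ b (λ q → Ext (toℕ q) M γ) (λ q → ext? (toℕ q) M γ) (λ ext → ¬generic (γ , γ◂M , ext)) in
        ≤-trans (≤-reflexive (sym (𝟙-yes (γ◂M , ¬ext) (fails? (toℕ q) γ M))))
            (∈⇒≤∑ (λ q → 𝟙 (fails? (toℕ q) γ M)) (∈-allFin q))

      numSpecial≤ : ∀ n → numSpecial n ≤ numFail n
      numSpecial≤ n = ≤-trans (∑-mono (structures n) λ M → go M (inS? M ×-dec ¬? (generic? b M)))
          (≤-reflexive (numFail≡ n))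
        where
        go : ∀ M (d : Dec (InS l I M × ¬ Generic b M)) → 𝟙 d ≤ ∑ (colourings n) (λ γ → fail γ M)
        go M (no _) = z≤n
        go M (yes (inS , ¬generic)) = let γ , γ◂M = inS⇒◂ inS in
          ≤-trans (not-generic γ γ◂M ¬generic) (∈⇒≤∑ (λ γ → fail γ M) (tuples-complete γ))

      -- A generic structure has at most `l ^ l` colourings. In any other structure each colouring
      -- fails some extension property and is therefore counted by `numFail`.
      total≤ : ∀ n → total n ≤ l ^ l * numGeneric n + numFail n
      total≤ n = begin
        total n
          ≡⟨ ∑-swap (colourings n) (structures n) (λ γ M → 𝟙 (γ ◂? M)) ⟩
        ∑ (structures n) (λ M → count (_◂? M) (colourings n))
          ≤⟨ ∑-mono (structures n) (λ M → go M (generic? b M)) ⟩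
        ∑ (structures n) (λ M → l ^ l * 𝟙 (generic? b M) + ∑ (colourings n) (λ γ → fail γ M))
          ≡⟨ trans (∑-+ (structures n) _ _) (cong₂ _+_ (∑-*ˡ (structures n) (l ^ l) _) (numFail≡ n)) ⟩
        l ^ l * numGeneric n + numFail n ∎
        where
        open ≤-Reasoning
        go : ∀ M (d : Dec (Generic b M)) → count (_◂? M) (colourings n) ≤ l ^ l * 𝟙 d + ∑ (colourings n)
            (λ γ → fail γ M)
        go M (yes (γ , γ◂M , ext)) = begin
          count (_◂? M) (colourings n)  ≤⟨ Good.colourings-bounded M γ γ◂M
              (λ q q< → allExt⇒ M γ ext q (≤-trans q< l+2≤b)) ⟩
          l ^ l                         ≡⟨ *-identityʳ (l ^ l) ⟨
          l ^ l * 1                     ≤⟨ m≤m+n (l ^ l * 1) _ ⟩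
          l ^ l * 1 + _                 ∎
        go M (no ¬generic) = ≤-trans (∑-mono (colourings n) (λ γ → one γ (γ ◂? M))) (m≤n+m _ (l ^ l * 0))
          where
          one : ∀ γ (d : Dec (γ ◂ M)) → 𝟙 d ≤ fail γ M
          one γ (no _)    = z≤n
          one γ (yes γ◂M) = not-generic γ γ◂M ¬generic

    abstract
      -- `numFail` is negligible against `total`, which `total≤` bounds by generic structures and
      -- `numFail` itself. The successor in `suc (K * l ^ l)` absorbs that last summand.
      special≪generic : numSpecial ≪ numGeneric
      special≪generic K = let N , p = ≪-∑ (allFin b) (λ q n → fails (toℕ q) n) (λ q → fails≪total (toℕ q)) (suc (K * l ^ l)) in
        N , λ n N≤n → ≤-trans (*-monoʳ-≤ K (numSpecial≤ n))
            (*-cancelˡ-≤ (l ^ l) {{m^n≢0 l l {{>-nonZero (≤-trans (n≤1+n 1) 2≤l)}}}}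
          (+-cancelʳ-≤ (numFail n) _ _ (begin
            l ^ l * (K * numFail n) + numFail n   ≡⟨ regroup (l ^ l) K (numFail n) ⟩
            suc (K * l ^ l) * numFail n           ≤⟨ p n N≤n ⟩
            total n                               ≤⟨ total≤ n ⟩
            l ^ l * numGeneric n + numFail n      ∎)))
        where
        open ≤-Reasoning
        regroup : ∀ a K x → a * (K * x) + x ≡ suc (K * a) * x
        regroup = solve-∀

    generic≤numS : ∀ n → numGeneric n ≤ numS n
    generic≤numS n = count-mono (generic? b) inS? (structures n) λ M (γ , γ◂M , _) → ◂⇒inS γ γ◂M

    generic-resp : ∀ {n} → Respects {n} (Generic b)
    generic-resp M≈N (γ , γ◂M , ext) = γ , ◂-resp γ M≈N γ◂M , λ q → ext-resp (toℕ q) γ M≈N (ext q)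

    -- At this `N` the special structures do not outnumber the generic ones. If there were none of
    -- the latter, `InS` would be empty at `N`, but it contains the structure with empty relations.
    generic-exists : ∃ λ n → ∃ λ (M : Structure L n) → Generic b M
    generic-exists = N , search (Any.any? (generic? b) (structures N))
      where
      open ≤-Reasoning
      N : ℕ
      N = proj₁ (special≪generic 1)
      search : Dec (Any (Generic b) (structures N)) → ∃ λ (M : Structure L N) → Generic b M
      search (yes any) = Any.satisfied any
      search (no none) = contradiction (≤-trans (numS>0 N) (begin
        numS N                      ≡⟨ count-split inS? (generic? b) (structures N) ⟨
        count (λ M → inS? M ×-dec generic? b M) (structures N) + numSpecial N
                                    ≤⟨ +-mono-≤ (count-mono (λ M → inS? M ×-dec generic? b M) (generic? b)
                                        (structures N) (λ _ → proj₂))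
                                         (≤-trans (m≤m+n (numSpecial N) 0) (proj₂ (special≪generic 1) N ≤-refl)) ⟩
        numGeneric N + numGeneric N ≡⟨ cong₂ _+_ none-generic none-generic ⟩
        0                           ∎)) λ ()
        where
        none-generic : numGeneric N ≡ 0
        none-generic = n≤0⇒n≡0 (count≤length (structureSetoid L N) (generic? b) (structures-unique N) [] λ M g →
          contradiction (let M′ , M′∈ , M≈M′ = find (structures-complete M) in lose M′∈ (generic-resp M≈M′ g)) none)

  private
    hasCard : ∀ {n} {P : Structure L n → Set} (P? : Decidable P) → Respects P → HasCard P (count P? (structures n))
    hasCard {n} P? resp = filter P? (structures n) ,
      UniqueSetoidₚ.filter⁺ (structureSetoid L n) P? (structures-unique n) ,
      (λ M → mk⇔ (proj₂ ∘ Membershipₚ.∈-filter⁻ (structureSetoid L n) P? resp {xs = structures n})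
                 (Membershipₚ.∈-filter⁺ (structureSetoid L n) P? resp (structures-complete M))) ,
      length-filter P? (structures n)

  -- Failures of `P` are special structures, hence negligible; decidability of `P` lets the
  -- structures with `P` be listed by filtering.
  almostAll : {P : ∀ {n} → Structure L n → Set} → (∀ {n} (M : Structure L n) → Dec (P M)) → (∀ {n} → Respects {n} P) →
              ∀ b → l + 2 ≤ b → (∀ {n} (M : Structure L n) → Generic b M → P M) → AlmostAll L l I P
  almostAll {P} P? resp b l+2≤b generic⇒P ε ε>0 = let N , p = special≪generic b l+2≤b (2 * ℚ.↧ₙ ε) in N , λ n N≤n →
    _ , (count (both? n) (structures n) , numS n , >-nonZero (numS>0 n) ,
         hasCard (both? n) (λ M≈N (s , q) → inS-resp M≈N s , resp M≈N q) , hasCard inS? inS-resp , refl) ,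
    ratio-close (count (both? n) (structures n)) (count (λ M → inS? M ×-dec ¬? (P? M)) (structures n)) (numS n)
      {{>-nonZero (numS>0 n)}} (count-split inS? P? (structures n)) ε ε>0 (begin
        2 * ℚ.↧ₙ ε * count (λ M → inS? M ×-dec ¬? (P? M)) (structures n)
          ≤⟨ *-monoʳ-≤ (2 * ℚ.↧ₙ ε) (count-mono (λ M → inS? M ×-dec ¬? (P? M)) (λ M → inS? M ×-dec ¬? (generic? b M))
              (structures n)
               λ M h → proj₁ h , proj₂ h ∘ generic⇒P M) ⟩
        2 * ℚ.↧ₙ ε * numSpecial b l+2≤b n
          ≤⟨ p n N≤n ⟩
        numGeneric b l+2≤b n
          ≤⟨ generic≤numS b l+2≤b n ⟩
        numS n ∎)
    where
    open ≤-Reasoning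
    both? : ∀ n (M : Structure L n) → Dec (InS l I M × P M)
    both? n M = inS? M ×-dec P? M

  module _ {n : ℕ} where

    ∀colourings? : {P : (Fin n → Fin l) → Set} → (∀ {γ γ′} → (∀ x → γ x ≡ γ′ x) → P γ → P γ′) →
                   (∀ γ → Dec (P γ)) → Dec (∀ γ → P γ)
    ∀colourings? resp P? = map′ (λ h γ → resp (lookup∘tabulate γ) (h (tabulate γ))) (λ h γ → h (lookup γ))
        (∀Vec? (P? ∘ lookup))

    strongColouring-cong : ∀ {M : Structure L n} {γ γ′ : Fin n → Fin l} → (∀ x → γ x ≡ γ′ x) → StrongColouring l M γ →
        StrongColouring l M γ′
    strongColouring-cong eq col k a h i j i≢j e = col k a h i j i≢j (trans (eq _) (trans e (sym (eq _))))

    strongColouring-resp : ∀ (γ : Fin n → Fin l) → Respects (λ M → StrongColouring l M γ)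
    strongColouring-resp γ M≈N col k a h = col k a (trans (M≈N k a) h)

  _⇔-dec_ : {X Y : Set} → Dec X → Dec Y → Dec (X ⇔ Y)
  d ⇔-dec e = map′ (λ (f , g) → mk⇔ f g) (λ eq → Equivalence.to eq , Equivalence.from eq)
      ((d →-dec e) ×-dec (e →-dec d))

  subst-⇔ : {X : Set} {a a′ b b′ : X} → a ≡ a′ → b ≡ b′ → a ≡ b → a′ ≡ b′
  subst-⇔ p q eq = trans (sym p) (trans eq q)

  Defined : ∀ {n} → Structure L n → Set
  Defined {n} M = (γ : Fin n → Fin l) → StrongColouring l M γ → (a b : Fin n) → (γ a ≡ γ b) ⇔ (M ⊨ ξ [ a ∷ b ∷ [] ])

  defined? : ∀ {n} (M : Structure L n) → Dec (Defined M)
  defined? M = ∀colourings?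
    (λ eq h col a b → let h′ = h (strongColouring-cong {M = M} (sym ∘ eq) col) a b in
      mk⇔ (Equivalence.to h′ ∘ subst-⇔ (sym (eq a)) (sym (eq b))) (subst-⇔ (eq a) (eq b) ∘ Equivalence.from h′))
    λ γ → strongColouring? M γ →-dec Fin.all? λ a → Fin.all? λ b → (γ a Fin.≟ γ b) ⇔-dec (M ⊨? ξ [ a ∷ b ∷ [] ])

  defined-resp : ∀ {n} → Respects {n} Defined
  defined-resp M≈N h γ col a b = let h′ = h γ (strongColouring-resp γ (≈-sym M≈N) col) a b in
    mk⇔ (⊨-resp ξ _ M≈N ∘ Equivalence.to h′) (Equivalence.from h′ ∘ ⊨-resp ξ _ (≈-sym M≈N))

  almostAll-defined : AlmostAll L l I Defined
  almostAll-defined = almostAll defined? defined-resp (l + 2) ≤-refl λ M (γ , γ◂M , ext) → ξ-defines M γ γ◂M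
      (allExt⇒ M γ ext)

  unique? : ∀ {n} (M : Structure L n) → Dec (UniquelyStronglyColourable l M)
  unique? {n} M = map′ (λ p → let γ , _ , h = find p in lookup γ , h) (λ (γ , h) → lose (tuples-complete (tabulate γ)) (strongColouring-tabulate {M = M} h))
      (Any.any? (λ γ → strongColouring? M (lookup γ)) (colourings n))
    ×-dec ∀colourings? (λ eq h γ′ col col′ a b → let h′ = h γ′ (strongColouring-cong {M = M} (sym ∘ eq) col) col′ a b in
              mk⇔ (Equivalence.to h′ ∘ subst-⇔ (sym (eq a)) (sym (eq b))) (subst-⇔ (eq a) (eq b) ∘ Equivalence.from h′))
      λ γ → ∀colourings? (λ eq h col col′ a b → let h′ = h col (strongColouring-cong {M = M} (sym ∘ eq) col′) a b in
              mk⇔ (subst-⇔ (eq a) (eq b) ∘ Equivalence.to h′) (Equivalence.from h′ ∘ subst-⇔ (sym (eq a)) (sym (eq b))))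
      λ γ′ → strongColouring? M γ →-dec
          (strongColouring? M γ′ →-dec Fin.all? λ a → Fin.all? λ b → (γ a Fin.≟ γ b) ⇔-dec (γ′ a Fin.≟ γ′ b))

  unique-resp : ∀ {n} → Respects {n} (UniquelyStronglyColourable l)
  unique-resp M≈N ((γ , col) , h) = (γ , strongColouring-resp γ M≈N col) , λ γ₁ γ₂ col₁ col₂ →
    h γ₁ γ₂ (strongColouring-resp γ₁ (≈-sym M≈N) col₁) (strongColouring-resp γ₂ (≈-sym M≈N) col₂)

  almostAll-unique : AlmostAll L l I (UniquelyStronglyColourable l)
  almostAll-unique = almostAll unique? unique-resp (l + 2) ≤-refl λ M (γ , γ◂M , ext) → Good.unique-colouring M γ γ◂M
      (allExt⇒ M γ ext)

  private
    side : ∀ {n b} (M : Structure L n) (γ : Colouring n) → γ ◂ M → AllExt b M γ → Side b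
    side M γ γ◂M ext = record { structure = M ; colouring = γ ; coloured = γ◂M ; ext = allExt⇒ M γ ext }

    -- With arities at least 2 there are no atoms over no variables other than equalities, so any
    -- two sides match at the start.
    start : ∀ {b} {A B : Side b} → Position A B [] []
    start = record { preserve = λ () ; reflect = λ () ; atoms = λ k t → contradiction t
        (nonempty (2≤arity k)) ; colours = λ () }
      where
      nonempty : ∀ {r} → 2 ≤ r → ¬ Vec (Fin 0) r
      nonempty (s≤s _) (() ∷ _)

  -- In the maximum, `l + 2` is what `almostAll` asks for, while `qr φ` covers the rounds of the
  -- game that starts from the empty position.
  zeroOneLaw : ZeroOneLaw L l I
  zeroOneLaw φ with _ , M₀ , γ₀ , γ₀◂M₀ , ext₀ ← generic-exists ((l + 2) ⊔ qr φ) (m≤m⊔n (l + 2) (qr φ)) | M₀ ⊨? φ [ [] ]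
  ... | yes h = inj₁ (almostAll (_⊨? φ [ [] ]) (⊨-resp φ []) ((l + 2) ⊔ qr φ) (m≤m⊔n (l + 2) (qr φ)) λ M
      (γ , γ◂M , ext) →
    transfer {A = side M₀ γ₀ γ₀◂M₀ ext₀} {side M γ γ◂M ext} φ (m≤n⊔m (l + 2) (qr φ)) start h)
  ... | no ¬h = inj₂ (almostAll (_⊨? ¬′ φ [ [] ]) (⊨-resp (¬′ φ) []) ((l + 2) ⊔ qr φ) (m≤m⊔n (l + 2) (qr φ)) λ M
      (γ , γ◂M , ext) →
    transfer {A = side M₀ γ₀ γ₀◂M₀ ext₀} {side M γ γ◂M ext} (¬′ φ) (m≤n⊔m (l + 2) (qr φ)) start ¬h)

theorem10p4 : (l : ℕ) → 2 ≤ l →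
    (L : Vocabulary) → 0 < ρ L →
    (∀ k → 2 ≤ arity L k) →
    (∀ k → arity L k ≤ l) →
    (I : Subset (ρ L)) →
    (∃ λ (ξ : Formula L 2) →
    AlmostAll L l I λ {n} M →
    (γ : Fin n → Fin l) → StrongColouring l M γ →
    (a b : Fin n) → (γ a ≡ γ b) ⇔ (M ⊨ ξ [ a ∷ b ∷ [] ]))
    × AlmostAll L l I (λ M → UniquelyStronglyColourable l M)
    × ZeroOneLaw L l I
theorem10p4 l 2≤l L 0<ρ 2≤arity arity≤l I =
  (Cliques.Relation.ξ l L I R (2≤arity R) (arity≤l R) , almostAll-defined) , almostAll-unique , zeroOneLaw
  where
  -- The relation in which all cliques are formed; the arity bounds hold for it as for every symbol.
  R : Fin (ρ L)
  R = Fin.fromℕ< 0<ρ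
  open Limits l 2≤l L I R 2≤arity arity≤l
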